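{- Let $m\in\mathbb{N}$ with $m \geq 2$. Then $$P^*_{DP}(K_4,m) = \begin{cases} m^4 - 6m^3 + 15m^2 - 13m & \text{if } m \text{ is even} \\ m^4 - 6m^3 + 15m^2 - 13m-3 & \text{if } m \text{ is odd.} \end{cases}$$ Consequently, there is no $N \in \mathbb{N}$ and polynomial $p(m)$ such that $P_{DP}^*(K_4,m) = p(m)$ for all integers $m \geq N$.
   Context: All graphs are nonempty, finite and simple; $\mathbb{N}=\{1,2,3,\ldots\}$; $K_4$ is the complete graph on 4 vertices. For a graph $H$ and $A,B\subseteq V(H)$, $E_H(A,B)$ is the set of edges of $H$ with one endpoint in $A$ and the other in $B$. A (DP-)cover of a graph $G$ is a pair $\mathcal{H}=(L,H)$, where $H$ is a graph and $L:V(G)\to 2^{V(H)}$ is a function such that: (1) $\{L(v):v\in V(G)\}$ is a partition of $V(H)$ into $|V(G)|$ parts; (2) for every pair of adjacent vertices $u,v\in V(G)$, the edges in $E_H(L(u),L(v))$ form a (possibly empty) matching; (3) $E(H)=\bigcup_{uv\in E(G)}E_H(L(u),L(v))$. It is an $m$-fold cover if $|L(v)|=m$ for all $v\in V(G)$, and an $m$-fold cover is full if $|E_H(L(u),L(v))|=m$ for each $uv\in E(G)$. A transversal of $\mathcal{H}$ is a set $T\subseteq V(H)$ containing exactly one vertex of $L(v)$ for each $v\in V(G)$; it is a proper $\mathcal{H}$-coloring of $G$ if it is an independent set in $H$. $P_{DP}(G,\mathcal{H})$ denotes the number of proper $\mathcal{H}$-colorings of $G$. The dual DP color function $P^*_{DP}(G,m)$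 is the maximum of $P_{DP}(G,\mathcal{H})$ over all full $m$-fold covers $\mathcal{H}$ of $G$. -}

module Defs where

open import Algebra.Bundles using (CommutativeRing)
open import Data.Fin using (Fin; _<_; _<?_)
open import Data.Fin.Properties using (all?) renaming (_≟_ to _≟ᶠ_)
open import Data.Fin.Subset using (Subset; inside; outside; _∩_; ∣_∣; Nonempty)
  renaming (_∈_ to _∈ˢ_)
open import Data.Fin.Subset.Properties using () renaming (_∈?_ to _∈ˢ?_)
open import Data.Integer using (ℤ; +_; _^_) renaming (_+_ to _+ᶻ_; _*_ to _*ᶻ_; _-_ to _-ᶻ_)
open import Data.List using (List; []; _∷_; _++_; map; length; filter; allFin; cartesianProduct)
open import Data.List.Membership.Propositional using (_∈_)
open import Data.Nat using (ℕ; zero; suc; NonZero; _≤_) renaming (_≟_ to _≟ⁿ_)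
open import Data.Nat.Divisibility using (_∣?_)
open import Data.Bool using (if_then_else_)
open import Data.Product using (_×_; _,_; ∃; ∃-syntax; ∃!)
open import Data.Sum using (_⊎_)
open import Data.Vec using ([]; _∷_)
open import Function using (_∘_)
open import Function.Bundles using (_⇔_)
open import Level using (0ℓ)
open import Relation.Binary using (Rel; Decidable; Irreflexive; Symmetric)
open import Relation.Binary.PropositionalEquality using (_≡_; _≢_; refl; sym)
open import Relation.Nullary using (¬_; Dec; does)
open import Relation.Nullary.Decidable using (_×-dec_; _⊎-dec_; _→-dec_; ¬?)

record Graph : Set₁ where
  field
    order    : ℕ
    nonempty : NonZero order
    Adj      : Rel (Fin order) 0ℓ
    adj?     : Decidable Adj
    irrefl   : Irreflexive _≡_ Adj
    symm     : Symmetric Adj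

  V : Set
  V = Fin order

  -- The edge {x , y} is listed once, as the pair (x , y) with x < y.
  edges : List (V × V)
  edges = filter (λ (x , y) → (x <? y) ×-dec adj? x y)
                 (cartesianProduct (allFin order) (allFin order))

  Joins : Subset order → Subset order → V × V → Set
  Joins A B (x , y) = (x ∈ˢ A × y ∈ˢ B) ⊎ (x ∈ˢ B × y ∈ˢ A)

  joins? : ∀ A B e → Dec (Joins A B e)
  joins? A B (x , y) =
    ((x ∈ˢ? A) ×-dec (y ∈ˢ? B)) ⊎-dec ((x ∈ˢ? B) ×-dec (y ∈ˢ? A))

  edgesBetween : Subset order → Subset order → List (V × V)
  edgesBetween A B = filter (joins? A B) edges

  Endpoint : V → V × V → Set
  Endpoint z (x , y) = z ≡ x ⊎ z ≡ y

  IsMatching : List (V × V) → Set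
  IsMatching M = ∀ {e f} → e ∈ M → f ∈ M →
                 ∀ z → Endpoint z e → Endpoint z f → e ≡ f

  Independent : Subset order → Set
  Independent T = ∀ x y → x ∈ˢ T → y ∈ˢ T → ¬ Adj x y

  independent? : ∀ T → Dec (Independent T)
  independent? T = all? λ x → all? λ y →
    (x ∈ˢ? T) →-dec ((y ∈ˢ? T) →-dec ¬? (adj? x y))

complete : ∀ n → .{{NonZero n}} → Graph
complete (suc n) = record
  { order    = suc n
  ; nonempty = _
  ; Adj      = _≢_
  ; adj?     = λ x y → ¬? (x ≟ᶠ y)
  ; irrefl   = λ x≡y x≢y → x≢y x≡y
  ; symm     = λ x≢y → x≢y ∘ sym
  }

K₄ : Graph
K₄ = complete 4

record Cover (G : Graph) : Set₁ where
  private module G = Graph G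
  field
    H : Graph
  private module H = Graph H
  field
    L          : G.V → Subset H.order
    L-nonempty : ∀ v → Nonempty (L v)
    L-unique   : ∀ x → ∃! _≡_ λ v → x ∈ˢ L v
    matching   : ∀ {u v} → G.Adj u v → H.IsMatching (H.edgesBetween (L u) (L v))
    H-edges    : ∀ e → (e ∈ H.edges) ⇔
                 (∃[ u ] ∃[ v ] G.Adj u v × e ∈ H.edgesBetween (L u) (L v))

  IsFold : ℕ → Set
  IsFold m = ∀ v → ∣ L v ∣ ≡ m

  IsFullFold : ℕ → Set
  IsFullFold m =
    IsFold m × (∀ {u v} → G.Adj u v → length (H.edgesBetween (L u) (L v)) ≡ m)

  IsTransversal : Subset H.order → Set
  IsTransversal T = ∀ v → ∣ T ∩ L v ∣ ≡ 1

  IsProperColoring : Subset H.order → Set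
  IsProperColoring T = IsTransversal T × H.Independent T

  isProperColoring? : ∀ T → Dec (IsProperColoring T)
  isProperColoring? T =
    all? (λ v → ∣ T ∩ L v ∣ ≟ⁿ 1) ×-dec H.independent? T

allSubsets : ∀ n → List (Subset n)
allSubsets zero    = [] ∷ []
allSubsets (suc n) =
  map (inside ∷_) (allSubsets n) ++ map (outside ∷_) (allSubsets n)

P-DP : (G : Graph) → Cover G → ℕ
P-DP G 𝓗 = length (filter isProperColoring? (allSubsets (Graph.order H)))
  where open Cover 𝓗

-- The dual DP color function is given by its graph: k is the value at m when
-- k is the maximum of P-DP over the full m-fold covers.
record IsP*-DP (G : Graph) (m k : ℕ) : Set₁ where
  field
    attained : ∃ λ (𝓗 : Cover G) → Cover.IsFullFold 𝓗 m × P-DP G 𝓗 ≡ k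
    maximal  : ∀ (𝓗 : Cover G) → Cover.IsFullFold 𝓗 m → P-DP G 𝓗 ≤ k

formula : ℕ → ℤ
formula m = if does (2 ∣? m) then q else q -ᶻ + 3
  where
  x q : ℤ
  x = + m
  q = x ^ 4 -ᶻ + 6 *ᶻ x ^ 3 +ᶻ + 15 *ᶻ x ^ 2 -ᶻ + 13 *ᶻ x

module _ {c ℓ} (R : CommutativeRing c ℓ) where
  open CommutativeRing R
    using (Carrier; _≈_; _+_; _*_; 0#; 1#; semiring)
  open import Algebra.Properties.Semiring.Mult semiring
    using () renaming (_×_ to _·_)

  natEmbed : ℕ → Carrier
  natEmbed n = n · 1#

  CharacteristicZero : Set ℓ
  CharacteristicZero = ∀ n → natEmbed n ≈ 0# → n ≡ 0

  -- Coefficients in order of increasing degree.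
  Polynomial : Set c
  Polynomial = List Carrier

  eval : Polynomial → Carrier → Carrier
  eval []      x = 0#
  eval (a ∷ p) x = a + x * eval p x

{-# OPTIONS --safe #-}

-- Naming the vertices of the cover so that the matchings at one vertex of K₄ are identities, a full
-- m-fold cover is given by three permutations α, β, γ along the remaining triangle, and its proper
-- colorings are the quadruples (a , b , c , d) with a ≢ b, c, d and α b ≢ c, β c ≢ d, γ d ≢ b.
-- Summing out the variables turns their number into m⁴ - 6m³ + 15m² - 13m minus a sum over x of a
-- deficiency that is nonnegative for m ≥ 3 and counts, among others, the points where the monodromy of
-- a 4-cycle, one of α⁻¹ ~ β, α ~ γ⁻¹, β⁻¹ ~ γ, is nontrivial. If all three agree then α = β = γ is an
-- involution, which for odd m has a fixed point, of deficiency at least 3; if exactly one fails it fails at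
-- three points x, α x, α⁻¹ x; and each that fails does so at two points at least.
-- The bounds are attained by β = γ = α⁻¹ with α a product of transpositions and, for odd m, one 3-cycle.
-- An eventually polynomial sequence is killed by some power of the difference operator, which only
-- multiplies an alternating sequence by powers of - 2, so the parity term is not polynomial.

module Submission where

open import Defs
open import Algebra.Bundles using (CommutativeRing)
open import Data.Bool using (true; false; if_then_else_)
open import Data.Fin using (Fin; zero; suc; combine; remQuot; _<?_) renaming (_<_ to _<ᶠ_)
open import Data.Fin.Patterns using (0F; 1F; 2F; 3F)
open import Data.Fin.Permutation
  using (Permutation′; permutation; _⟨$⟩ʳ_; _⟨$⟩ˡ_; inverseʳ; inverseˡ; flip; id)
open import Data.Fin.Properties
  using (any?; all?; ¬∀⟶∃¬; suc-injective; punchOut-injective; injective⇒≤; <-cmp; <-asym; remQuot-combine; combine-remQuot)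
  renaming (_≟_ to _≟ᶠ_)
open import Data.Fin.Subset using (Subset; inside; outside; _∩_; ∣_∣; ⁅_⁆) renaming (_∈_ to _∈ˢ_)
open import Data.Fin.Subset.Properties
  using (x∈p∩q⁺; x∈p∩q⁻; ∣⁅x⁆∣≡1; x∈⁅x⁆; x∈⁅y⁆⇒x≡y; ⊆-antisym)
import Data.Integer.Properties as ℤₚ
open import Data.Integer.Tactic.RingSolver using (solve-∀)
open import Data.List using (List; []; _∷_; map; length; lookup; filter; allFin; cartesianProduct; tabulate)
open import Data.List.Membership.Propositional using (_∈_)
open import Data.List.Membership.Propositional.Properties
  using (∈-lookup; ∈-filter⁺; ∈-filter⁻; ∈-allFin; ∈-cartesianProduct⁺; ∈-map⁺; ∈-map⁻; ∈-++⁺ˡ; ∈-++⁺ʳ)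
open import Data.List.Properties using (filter-++; length-++; length-tabulate)
open import Data.List.Relation.Unary.All as All using ()
open import Data.List.Relation.Unary.Any using (index; here)
open import Data.List.Relation.Unary.Any.Properties using (lookup-index)
open import Data.List.Relation.Unary.Unique.Propositional using (Unique; []; _∷_)
import Data.List.Relation.Unary.Unique.Propositional.Properties as Unique
open import Data.Nat using (ℕ; zero; suc; _≤_; _≤?_; z≤n; s≤s; NonZero)
import Data.Nat as ℕ
open import Data.Nat.Divisibility using (_∣_; _∣?_; divides; ∣m+n∣m⇒∣n; ∣m∣n⇒∣m+n; ∣-refl)
import Data.Nat.Properties as ℕₚ
open import Data.Product using (_×_; _,_; ∃; ∃-syntax; proj₁; proj₂)
open import Data.Sum using (_⊎_; inj₁; inj₂)
open import Data.Vec using ([]; _∷_; here; there)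
import Data.Vec as Vec
open import Data.Vec.Properties using ([]=⇒lookup; lookup⇒[]=; lookup∘tabulate)
open import Function using (_∘_; _∋_; case_of_)
open import Function.Bundles using (_⇔_; mk⇔; module Equivalence)
open import Function.Definitions using (Injective)
open import Relation.Binary using (tri<; tri≈; tri>)
open import Relation.Nullary using (¬_; Dec; yes; no; does; contradiction)
open import Relation.Nullary.Decidable using (_×-dec_; ¬?; dec-true; dec-false; does-⇔)
open import Relation.Unary using (Decidable)
open import Relation.Binary.PropositionalEquality as ≡ using (_≡_)

-- Counting with integer indicators turns the comparison of covers into one polynomial identity at
-- each x. The summand is largest, namely 4m - 7, where none of the four triangles of K₄ has a
-- closed lift and all three 4-cycles have one. Only parity sets these two demands against each
-- other: closed 4-cycles make the three permutations one involution, and a fixed point of it closes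
-- every triangle as well. The constant 3 arises twice, as the least length of a cycle that differs
-- from its inverse and as the number of products tᵢ sᵢ that a common fixed point turns on. The
-- second half works over any commutative ring of characteristic zero. There only multiples of 1 can
-- be tested against zero, so the argument avoids division and ends with a natural number whose
-- image would have to be 0.

-- The value at m is positivePart m - negativePart m - defect m, split by sign so that no subtraction occurs in ℕ.
positivePart negativePart : ℕ → ℕ
positivePart m = 0 ℕ.+ m ℕ.* (0 ℕ.+ m ℕ.* (15 ℕ.+ m ℕ.* (0 ℕ.+ m ℕ.* 1)))
negativePart m = 0 ℕ.+ m ℕ.* (13 ℕ.+ m ℕ.* (0 ℕ.+ m ℕ.* 6))

-- Recursion in steps of two makes `defect (2 + m)` and `defect m` the same term. The period 2 of
-- the parity term, and the invariance under adjoining a transposition, then need no proof.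
defect : ℕ → ℕ
defect 0             = 0
defect 1             = 3
defect (suc (suc m)) = defect m

defect-even+ : ∀ n j → defect (n ℕ.* 2 ℕ.+ j) ≡ defect j
defect-even+ zero    j = ≡.refl
defect-even+ (suc n) j = defect-even+ n j

-- Finite differences and the failure of polynomiality

module FiniteDifferences {c ℓ} (R : CommutativeRing c ℓ) where
  open CommutativeRing R
  open import Algebra.Properties.Ring ring using (-‿distribʳ-*; -‿involutive; -0#≈0#; -‿+-comm)
  open import Algebra.Properties.Semiring.Mult semiring using (×1-homo-*; ×-homo-+)
  open import Relation.Binary.Reasoning.Setoid setoid
  open import Algebra.Properties.CommutativeSemigroup +-commutativeSemigroup using (interchange; x∙yz≈y∙xz)

  Δ : (ℕ → Carrier) → ℕ → Carrier
  Δ f m = f (suc m) - f m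

  -- Stands in for "degree below n": it survives every step of Horner's scheme and asks for no
  -- division in the ring.
  Vanishes : ℕ → (ℕ → Carrier) → Set ℓ
  Vanishes zero    f = ∀ m → f m ≈ 0#
  Vanishes (suc n) f = Vanishes n (Δ f)

  vanishes-cong : ∀ n {f g} → (∀ m → f m ≈ g m) → Vanishes n f → Vanishes n g
  vanishes-cong zero    f≈g Δf≈0 m = trans (sym (f≈g m)) (Δf≈0 m)
  vanishes-cong (suc n) f≈g Δf≈0 = vanishes-cong n (λ m → +-cong (f≈g (suc m)) (-‿cong (f≈g m))) Δf≈0

  vanishes-0 : ∀ n {f} → (∀ m → f m ≈ 0#) → Vanishes n f
  vanishes-0 zero    f≈0 = f≈0
  vanishes-0 (suc n) f≈0 = vanishes-0 n λ m → trans (+-cong (f≈0 (suc m)) (-‿cong (f≈0 m))) (-‿inverseʳ 0#)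

  vanishes-suc : ∀ n {f} → Vanishes n f → Vanishes (suc n) f
  vanishes-suc zero    f≈0  = vanishes-0 1 f≈0
  vanishes-suc (suc n) Δf≈0 = vanishes-suc n Δf≈0

  vanishes-+ℕ : ∀ k n {f} → Vanishes n f → Vanishes (k ℕ.+ n) f
  vanishes-+ℕ zero    n v = v
  vanishes-+ℕ (suc k) n v = vanishes-suc (k ℕ.+ n) (vanishes-+ℕ k n v)

  vanishes-shift : ∀ k n {f} → Vanishes n f → Vanishes n (f ∘ (k ℕ.+_))
  vanishes-shift k zero    v = v ∘ (k ℕ.+_)
  vanishes-shift k (suc n) {f} v = vanishes-cong n
    (λ m → +-congʳ (reflexive (≡.cong f (≡.sym (ℕₚ.+-suc k m))))) (vanishes-shift k n v)

  vanishes-+ : ∀ n {f g} → Vanishes n f → Vanishes n g → Vanishes n (λ m → f m + g m)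
  vanishes-+ zero    f≈0 g≈0 m = trans (+-cong (f≈0 m) (g≈0 m)) (+-identityˡ 0#)
  vanishes-+ (suc n) {f} {g} v w = vanishes-cong n
    (λ m → trans (interchange _ _ _ _) (+-congˡ (-‿+-comm (f m) (g m)))) (vanishes-+ n v w)

  -- The discrete Leibniz rule: Δ (m f) = m Δf + f (m + 1).
  vanishes-*m : ∀ n {f} → Vanishes n f → Vanishes (suc n) (λ m → natEmbed R m * f m)
  vanishes-*m zero    f≈0 = vanishes-0 1 λ m → trans (*-congˡ (f≈0 m)) (zeroʳ _)
  vanishes-*m (suc n) {f} v = vanishes-cong (suc n) leibniz
    (vanishes-+ (suc n) (vanishes-*m n v) (vanishes-shift 1 (suc n) v))
    where
    leibniz : ∀ m → natEmbed R m * Δ f m + f (suc m) ≈ natEmbed R (suc m) * f (suc m) - natEmbed R m * f m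
    leibniz m = begin
      k * (f (suc m) - f m) + f (suc m)           ≈⟨ +-congʳ (distribˡ k _ _) ⟩
      k * f (suc m) + k * (- f m) + f (suc m)     ≈⟨ +-congʳ (+-congˡ (-‿distribʳ-* k (f m))) ⟨
      k * f (suc m) - k * f m + f (suc m)         ≈⟨ +-comm _ _ ⟩
      f (suc m) + (k * f (suc m) - k * f m)       ≈⟨ +-assoc _ _ _ ⟨
      f (suc m) + k * f (suc m) - k * f m         ≈⟨ +-congʳ (+-congʳ (*-identityˡ _)) ⟨
      1# * f (suc m) + k * f (suc m) - k * f m    ≈⟨ +-congʳ (distribʳ (f (suc m)) 1# k) ⟨
      (1# + k) * f (suc m) - k * f m              ∎
      where k = natEmbed R m

  vanishes-const : ∀ n a → Vanishes (suc n) (λ _ → a)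
  vanishes-const n a = vanishes-0 n λ _ → -‿inverseʳ a

  vanishes-eval : ∀ p → Vanishes (length p) (λ m → eval R p (natEmbed R m))
  vanishes-eval []      = λ m → refl
  vanishes-eval (a ∷ p) = vanishes-+ (suc (length p))
    (vanishes-const (length p) a) (vanishes-*m (length p) (vanishes-eval p))

  Alternating : (ℕ → Carrier) → Set ℓ
  Alternating f = ∀ m → f (suc m) ≈ - f m

  -- Here `Δ f` is - 2 f and alternates again, so each difference costs one factor 2. The factor
  -- stays in the conclusion, because characteristic zero only tests multiples of 1 and does not
  -- cancel 2 against an arbitrary ring element.
  alternating-vanishes : ∀ n {f} → Alternating f → Vanishes n f → natEmbed R (2 ℕ.^ n) * f 0 ≈ 0#
  alternating-vanishes zero {f} alt f≈0 = trans (*-congˡ (f≈0 0)) (zeroʳ _)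
  alternating-vanishes (suc n) {f} alt Δf≈0 = begin
    natEmbed R (2 ℕ.* 2 ℕ.^ n) * f 0         ≈⟨ *-congʳ (×1-homo-* 2 (2 ℕ.^ n)) ⟩
    (natEmbed R 2 * N) * f 0                 ≈⟨ *-congʳ (*-comm _ N) ⟩
    (N * natEmbed R 2) * f 0                 ≈⟨ *-assoc N _ _ ⟩
    N * (natEmbed R 2 * f 0)                 ≈⟨ *-congˡ two ⟩
    N * (f 0 + f 0)                          ≈⟨ *-congˡ (-‿involutive _) ⟨
    N * (- - (f 0 + f 0))                    ≈⟨ *-congˡ (-‿cong (-‿+-comm (f 0) (f 0))) ⟨
    N * (- (- f 0 - f 0))                    ≈⟨ *-congˡ (-‿cong (+-congʳ (alt 0))) ⟨
    N * (- Δ f 0)                            ≈⟨ -‿distribʳ-* N _ ⟨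
    - (N * Δ f 0)                            ≈⟨ -‿cong (alternating-vanishes n alt-Δ Δf≈0) ⟩
    - 0#                                     ≈⟨ -0#≈0# ⟩
    0#                                       ∎
    where
    N = natEmbed R (2 ℕ.^ n)
    two : natEmbed R 2 * f 0 ≈ f 0 + f 0
    two = trans (*-congʳ (+-congˡ (+-identityʳ 1#))) (trans (distribʳ _ _ _) (+-cong (*-identityˡ _) (*-identityˡ _)))
    alt-Δ : Alternating (Δ f)
    alt-Δ m = begin
      f (suc (suc m)) - f (suc m)  ≈⟨ +-cong (alt (suc m)) (-‿cong (alt m)) ⟩
      - f (suc m) - (- f m)        ≈⟨ -‿+-comm _ _ ⟩
      - Δ f m                      ∎

  vanishes-neg : ∀ n {f} → Vanishes n f → Vanishes n (λ m → - f m)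
  vanishes-neg zero    f≈0 m = trans (-‿cong (f≈0 m)) -0#≈0#
  vanishes-neg (suc n) {f} v = vanishes-cong n (λ m → sym (-‿+-comm _ _)) (vanishes-neg n v)

  -- One Horner step raises the order by one. `positivePart` and `negativePart` spell out their zero
  -- coefficients so that this lemma applies once per degree.
  vanishes-horner : ∀ n c {s : ℕ → ℕ} → Vanishes n (natEmbed R ∘ s) →
    Vanishes (suc n) (λ m → natEmbed R (c ℕ.+ m ℕ.* s m))
  vanishes-horner n c {s} v = vanishes-cong (suc n)
    (λ m → sym (trans (×-homo-+ 1# c (m ℕ.* s m)) (+-congˡ (×1-homo-* m (s m)))))
    (vanishes-+ (suc n) (vanishes-const n (natEmbed R c)) (vanishes-*m n v))

  negativePart-vanishes : Vanishes 5 (natEmbed R ∘ negativePart)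
  negativePart-vanishes = vanishes-suc 4 (vanishes-horner 3 0 (vanishes-horner 2 13 (vanishes-horner 1 0 (vanishes-const 0 _))))

  positivePart-vanishes : Vanishes 5 (natEmbed R ∘ positivePart)
  positivePart-vanishes = vanishes-horner 4 0 (vanishes-horner 3 0 (vanishes-horner 2 15 (vanishes-horner 1 0 (vanishes-const 0 _))))

  -- Removing the polynomial part of the value from p leaves `- defect`, of period 2, whose
  -- differences alternate between - 3 and 3. If some power of `Δ` killed it, the image of 2ⁿ * 3 in
  -- R would be zero.
  not-polynomial : CharacteristicZero R → (k : ℕ → ℕ) →
    (∀ m → 2 ≤ m → k m ℕ.+ defect m ℕ.+ negativePart m ≡ positivePart m) → ∀ N p → 1 ≤ N →
    ¬ (∀ m → N ≤ m → natEmbed R (k m) ≈ eval R p (natEmbed R m))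
  not-polynomial char0 k k-defect N p 1≤N k≈p = contradiction
    (char0 (2 ℕ.^ n ℕ.* 3) (begin
      natEmbed R (2 ℕ.^ n ℕ.* 3)               ≈⟨ ×1-homo-* (2 ℕ.^ n) 3 ⟩
      natEmbed R (2 ℕ.^ n) * natEmbed R 3      ≈⟨ *-congˡ (-‿involutive _) ⟨
      natEmbed R (2 ℕ.^ n) * (- - natEmbed R 3)  ≈⟨ -‿distribʳ-* _ _ ⟨
      - (natEmbed R (2 ℕ.^ n) * - natEmbed R 3)  ≈⟨ -‿cong (*-congˡ Δg0) ⟨
      - (natEmbed R (2 ℕ.^ n) * Δ g 0)           ≈⟨ -‿cong (alternating-vanishes n alternating (vanishes-suc n {g} g-vanishes)) ⟩
      - 0#                                     ≈⟨ -0#≈0# ⟩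
      0#                                       ∎))
    (ℕ.≢-nonZero⁻¹ _ {{ℕₚ.m*n≢0 (2 ℕ.^ n) 3 {{ℕₚ.m^n≢0 2 n}}}})
    where
    n M : ℕ
    -- The 5 is one more than the degree of `positivePart`. `M` is at least `N` and even, so
    -- starting at `M` keeps the parity of the index.
    n = length p ℕ.+ 5
    M = N ℕ.* 2
    h g : ℕ → Carrier
    h m = eval R p (natEmbed R m) + (natEmbed R (negativePart m) - natEmbed R (positivePart m))
    g j = h (M ℕ.+ j)

    h-vanishes : Vanishes n h
    h-vanishes = vanishes-+ n
      (≡.subst (λ l → Vanishes l (λ m → eval R p (natEmbed R m))) (ℕₚ.+-comm 5 (length p)) (vanishes-+ℕ 5 (length p) (vanishes-eval p)))
      (vanishes-+ n (vanishes-+ℕ (length p) 5 negativePart-vanishes) (vanishes-neg n (vanishes-+ℕ (length p) 5 positivePart-vanishes)))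

    g-vanishes : Vanishes n g
    g-vanishes = vanishes-shift M n h-vanishes

    N≤M+ : ∀ j → N ≤ M ℕ.+ j
    N≤M+ j = ℕₚ.≤-trans (ℕₚ.m≤m*n N 2) (ℕₚ.m≤m+n M j)

    2≤M+ : ∀ j → 2 ≤ M ℕ.+ j
    2≤M+ j = ℕₚ.≤-trans (ℕₚ.*-monoˡ-≤ 2 1≤N) (ℕₚ.m≤m+n M j)

    g≈ : ∀ j → g j ≈ - natEmbed R (defect j)
    g≈ j = begin
      eval R p (natEmbed R m) + (s - natEmbed R (positivePart m))
        ≈⟨ +-cong (sym (k≈p m (N≤M+ j))) (+-congˡ (-‿cong
             (trans (reflexive (≡.cong (natEmbed R) (≡.sym (k-defect m (2≤M+ j)))))
               (trans (×-homo-+ 1# (k m ℕ.+ defect m) (negativePart m)) (+-congʳ (×-homo-+ 1# (k m) (defect m))))))) ⟩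
      a + (s - (a + d + s))
        ≈⟨ +-congˡ (+-congˡ (-‿+-comm (a + d) s)) ⟨
      a + (s + (- (a + d) - s))
        ≈⟨ +-congˡ (x∙yz≈y∙xz s _ _) ⟩
      a + (- (a + d) + (s - s))
        ≈⟨ +-congˡ (trans (+-congˡ (-‿inverseʳ s)) (+-identityʳ _)) ⟩
      a + - (a + d)
        ≈⟨ +-congˡ (-‿+-comm a d) ⟨
      a + (- a - d)
        ≈⟨ +-assoc a (- a) (- d) ⟨
      (a - a) - d
        ≈⟨ trans (+-congʳ (-‿inverseʳ a)) (+-identityˡ _) ⟩
      - d
        ≡⟨ ≡.cong (λ e → - natEmbed R e) (defect-even+ N j) ⟩
      - natEmbed R (defect j) ∎
      where
      m = M ℕ.+ j
      a = natEmbed R (k m)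
      d = natEmbed R (defect m)
      s = natEmbed R (negativePart m)

    alternating : Alternating (Δ g)
    alternating j = begin
      g (suc (suc j)) - g (suc j)    ≈⟨ +-congʳ (trans (g≈ (suc (suc j))) (sym (g≈ j))) ⟩
      g j - g (suc j)                ≈⟨ +-congʳ (-‿involutive (g j)) ⟨
      - - g j - g (suc j)            ≈⟨ +-comm _ _ ⟩
      - g (suc j) - (- g j)          ≈⟨ -‿+-comm _ _ ⟩
      - Δ g j                        ∎

    Δg0 : Δ g 0 ≈ - natEmbed R 3
    Δg0 = begin
      g 1 - g 0                  ≈⟨ +-cong (g≈ 1) (-‿cong (g≈ 0)) ⟩
      - natEmbed R 3 - (- 0#)    ≈⟨ +-congˡ (-‿involutive 0#) ⟩
      - natEmbed R 3 + 0#        ≈⟨ +-identityʳ _ ⟩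
      - natEmbed R 3             ∎

open import Data.Integer using (ℤ; +_; 0ℤ; 1ℤ; _+_; _*_; _-_; -_; _^_; +≤+) renaming (_≤_ to _≤ᶻ_; ∣_∣ to ∣_∣ᶻ)
open import Relation.Binary.PropositionalEquality
open import Algebra.Properties.Semiring.Sum ℤₚ.+-*-semiring
  using (sum; sum-syntax; sum-cong-≗; sum-replicate-zero; ∑-distrib-+; ∑-comm; ∑-permute; *-distribˡ-sum)

-- Sums of indicators over `Fin m`

private variable
  m : ℕ

ι : ∀ {A : Set} → Dec A → ℤ
ι a? = if does a? then 1ℤ else 0ℤ

δ ν : Fin m → Fin m → ℤ
δ i j = ι (i ≟ᶠ j)
ν i j = 1ℤ - δ i j

ι-⇔ : ∀ {A B : Set} → A ⇔ B → (a? : Dec A) (b? : Dec B) → ι a? ≡ ι b?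
ι-⇔ A⇔B a? b? = cong (if_then 1ℤ else 0ℤ) (does-⇔ A⇔B a? b?)

δ-sym : (i j : Fin m) → δ i j ≡ δ j i
δ-sym i j = ι-⇔ (mk⇔ sym sym) (i ≟ᶠ j) (j ≟ᶠ i)

ν-sym : (i j : Fin m) → ν i j ≡ ν j i
ν-sym i j = cong (_-_ 1ℤ) (δ-sym i j)

δ-transpose : (π : Permutation′ m) (i j : Fin m) → δ (π ⟨$⟩ʳ i) j ≡ δ i (π ⟨$⟩ˡ j)
δ-transpose π i j = ι-⇔ (mk⇔
  (λ πi≡j → trans (sym (inverseˡ π)) (cong (π ⟨$⟩ˡ_) πi≡j))
  (λ i≡π⁻j → trans (cong (π ⟨$⟩ʳ_) i≡π⁻j) (inverseʳ π)))
  ((π ⟨$⟩ʳ i) ≟ᶠ j) (i ≟ᶠ (π ⟨$⟩ˡ j))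

ν-transpose : (π : Permutation′ m) (i j : Fin m) → ν (π ⟨$⟩ʳ i) j ≡ ν i (π ⟨$⟩ˡ j)
ν-transpose π i j = cong (_-_ 1ℤ) (δ-transpose π i j)

∑-const : ∀ m c → ∑[ i < m ] c ≡ + m * c
∑-const zero    c = refl
∑-const (suc m) c = begin
  c + ∑[ i < m ] c    ≡⟨ cong (_+_ c) (∑-const m c) ⟩
  c + + m * c         ≡⟨ cong (_+ + m * c) (ℤₚ.*-identityˡ c) ⟨
  1ℤ * c + + m * c    ≡⟨ ℤₚ.*-distribʳ-+ c 1ℤ (+ m) ⟨
  + suc m * c         ∎
  where open ≡-Reasoning

∑-neg : (f : Fin m → ℤ) → ∑[ i < m ] (- f i) ≡ - sum f
∑-neg {m} f = begin
  ∑[ i < m ] (- f i)          ≡⟨ sum-cong-≗ (λ i → ℤₚ.-1*i≡-i (f i)) ⟨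
  ∑[ i < m ] (- 1ℤ * f i)     ≡⟨ *-distribˡ-sum (- 1ℤ) f ⟨
  - 1ℤ * sum f                ≡⟨ ℤₚ.-1*i≡-i (sum f) ⟩
  - sum f                     ∎
  where open ≡-Reasoning

∑-distrib-- : (f g : Fin m → ℤ) → ∑[ i < m ] (f i - g i) ≡ sum f - sum g
∑-distrib-- f g = trans (∑-distrib-+ f _) (cong (_+_ (sum f)) (∑-neg g))

∑-δ : (i : Fin m) (f : Fin m → ℤ) → ∑[ j < m ] (δ i j * f j) ≡ f i
∑-δ {suc n} zero f = begin
  1ℤ * f zero + ∑[ j < n ] 0ℤ   ≡⟨ cong₂ _+_ (ℤₚ.*-identityˡ (f zero)) (sum-replicate-zero n) ⟩
  f zero + 0ℤ                   ≡⟨ ℤₚ.+-identityʳ (f zero) ⟩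
  f zero                        ∎
  where open ≡-Reasoning
∑-δ (suc i) f = trans (ℤₚ.+-identityˡ _) (∑-δ i (f ∘ suc))

∑-δ-1 : (i : Fin m) → ∑[ j < m ] δ i j ≡ 1ℤ
∑-δ-1 i = trans (sum-cong-≗ (λ j → sym (ℤₚ.*-identityʳ (δ i j)))) (∑-δ i (λ _ → 1ℤ))

∑-ν : (i : Fin m) (f : Fin m → ℤ) → ∑[ j < m ] (ν i j * f j) ≡ sum f - f i
∑-ν {m} i f = begin
  ∑[ j < m ] (ν i j * f j)         ≡⟨ sum-cong-≗ (λ j → expand (δ i j) (f j)) ⟩
  ∑[ j < m ] (f j - δ i j * f j)   ≡⟨ ∑-distrib-- f _ ⟩
  sum f - ∑[ j < m ] (δ i j * f j) ≡⟨ cong (_-_ (sum f)) (∑-δ i f) ⟩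
  sum f - f i                      ∎
  where
  open ≡-Reasoning
  expand : ∀ d x → (1ℤ - d) * x ≡ x - d * x
  expand = solve-∀

∑-ν-1 : (i : Fin m) → ∑[ j < m ] ν i j ≡ + m - 1ℤ
∑-ν-1 {m} i = begin
  ∑[ j < m ] ν i j                     ≡⟨ sum-cong-≗ (λ j → ℤₚ.*-identityʳ (ν i j)) ⟨
  ∑[ j < m ] (ν i j * 1ℤ)              ≡⟨ ∑-ν i _ ⟩
  ∑[ j < m ] 1ℤ - 1ℤ                   ≡⟨ cong (_- 1ℤ) (trans (∑-const m 1ℤ) (ℤₚ.*-identityʳ (+ m))) ⟩
  + m - 1ℤ                             ∎
  where open ≡-Reasoning

∑-ν² : (x y : Fin m) → ∑[ j < m ] (ν x j * ν y j) ≡ + m - 1ℤ - ν y x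
∑-ν² x y = trans (∑-ν x (ν y)) (cong (_- ν y x) (∑-ν-1 y))

-- Inclusion-exclusion for a color that avoids three values: each coincidence gives one color back,
-- and a triple coincidence, seen three times, may give back only two.
∑-ν³ : (x y z : Fin m) →
  ∑[ j < m ] (ν x j * (ν y j * ν z j)) ≡
  (+ m - + 3) + δ z y + δ x y + δ x z - δ x y * δ x z
∑-ν³ {m} x y z = begin
  ∑[ j < m ] (ν x j * (ν y j * ν z j))         ≡⟨ ∑-ν x _ ⟩
  ∑[ j < m ] (ν y j * ν z j) - ν y x * ν z x   ≡⟨ cong (_- ν y x * ν z x) (∑-ν² y z) ⟩
  (+ m - 1ℤ - ν z y) - ν y x * ν z x           ≡⟨ cong₂ (λ a b → (+ m - 1ℤ - ν z y) - a * b) (ν-sym y x) (ν-sym z x) ⟩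
  (+ m - 1ℤ - ν z y) - ν x y * ν x z           ≡⟨ collect (+ m) (δ z y) (δ x y) (δ x z) ⟩
  (+ m - + 3) + δ z y + δ x y + δ x z - δ x y * δ x z ∎
  where
  open ≡-Reasoning
  collect : ∀ M a b c → (M - 1ℤ - (1ℤ - a)) - (1ℤ - b) * (1ℤ - c) ≡ (M - + 3) + a + b + c - b * c
  collect = solve-∀

∑³ : (Fin m → Fin m → Fin m → ℤ) → ℤ
∑³ {m} f = ∑[ a < m ] ∑[ b < m ] ∑[ c < m ] f a b c

∑³-cong : {f g : Fin m → Fin m → Fin m → ℤ} → (∀ a b c → f a b c ≡ g a b c) → ∑³ f ≡ ∑³ g
∑³-cong f≡g = sum-cong-≗ λ a → sum-cong-≗ λ b → sum-cong-≗ λ c → f≡g a b c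

∑³-distrib-+ : (f g : Fin m → Fin m → Fin m → ℤ) → ∑³ (λ a b c → f a b c + g a b c) ≡ ∑³ f + ∑³ g
∑³-distrib-+ {m} f g =
  trans (sum-cong-≗ λ a → trans (sum-cong-≗ λ b → ∑-distrib-+ (f a b) (g a b)) (∑-distrib-+ {m} _ _))
        (∑-distrib-+ {m} _ _)

∑³-distrib-- : (f g : Fin m → Fin m → Fin m → ℤ) → ∑³ (λ a b c → f a b c - g a b c) ≡ ∑³ f - ∑³ g
∑³-distrib-- {m} f g =
  trans (sum-cong-≗ λ a → trans (sum-cong-≗ λ b → ∑-distrib-- (f a b) (g a b)) (∑-distrib-- {m} _ _))
        (∑-distrib-- {m} _ _)

-- Counting the colorings for three given permutations

module Count {m} (α β γ : Permutation′ m) where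
  open ≡-Reasoning

  M : ℤ
  M = + m

  F : Fin m → Fin m → Fin m → ℤ
  F a b c = ν a b * (ν a c * ν (α ⟨$⟩ʳ b) c)

  -- The color `d` is innermost, since `F` does not depend on it and it can be summed out first. The
  -- third matching is read from `b` to `d`, so that all three constraints on `d` say that it avoids
  -- a given value.
  colorings : ℤ
  colorings = ∑³ λ a b c → F a b c * ∑[ d < m ] (ν a d * (ν (β ⟨$⟩ʳ c) d * ν (γ ⟨$⟩ˡ b) d))

  -- In the five terms x is a color in part 0, 2, 1, 3 and 0 respectively. With these choices the
  -- factors of the last product are literally those of the three terms before it, which allows a
  -- comparison point by point.
  G : Fin m → ℤ
  G x = (M - + 3) * ν (α ⟨$⟩ʳ x) x
      + ν (β ⟨$⟩ʳ x) x * (M - 1ℤ - ν (α ⟨$⟩ˡ x) (β ⟨$⟩ʳ x))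
      + ν (γ ⟨$⟩ˡ x) x * (M - 1ℤ - ν (α ⟨$⟩ʳ x) (γ ⟨$⟩ˡ x))
      + ν (α ⟨$⟩ʳ (γ ⟨$⟩ʳ x)) (β ⟨$⟩ˡ x) * (M - 1ℤ - ν (β ⟨$⟩ˡ x) (γ ⟨$⟩ʳ x))
      - ν (γ ⟨$⟩ˡ x) x * (ν (β ⟨$⟩ʳ x) x * ν (α ⟨$⟩ʳ (γ ⟨$⟩ʳ x)) (β ⟨$⟩ˡ x))

  -- S₀, …, S₄ are the sums of F against the terms into which ∑-ν³ expands the sum over d.
  S₀ : ∑³ F ≡ M * ((M - 1ℤ) * (M - + 2)) + ∑[ x < m ] ν (α ⟨$⟩ʳ x) x
  S₀ = begin
    ∑³ F
      ≡⟨ sum-cong-≗ (λ a → begin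
           ∑[ b < m ] ∑[ c < m ] (ν a b * (ν a c * ν (α ⟨$⟩ʳ b) c))
             ≡⟨ sum-cong-≗ (λ b → sym (*-distribˡ-sum (ν a b) (λ c → ν a c * ν (α ⟨$⟩ʳ b) c))) ⟩
           ∑[ b < m ] (ν a b * ∑[ c < m ] (ν a c * ν (α ⟨$⟩ʳ b) c))
             ≡⟨ sum-cong-≗ (λ b → cong (ν a b *_) (∑-ν² a (α ⟨$⟩ʳ b))) ⟩
           ∑[ b < m ] (ν a b * (M - 1ℤ - ν (α ⟨$⟩ʳ b) a))
             ≡⟨ ∑-ν a _ ⟩
           ∑[ b < m ] (M - 1ℤ - ν (α ⟨$⟩ʳ b) a) - (M - 1ℤ - ν (α ⟨$⟩ʳ a) a)
             ≡⟨ cong (_- (M - 1ℤ - ν (α ⟨$⟩ʳ a) a)) (begin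
                  ∑[ b < m ] (M - 1ℤ - ν (α ⟨$⟩ʳ b) a)
                    ≡⟨ ∑-distrib-- {m} (λ _ → M - 1ℤ) (λ b → ν (α ⟨$⟩ʳ b) a) ⟩
                  ∑[ b < m ] (M - 1ℤ) - ∑[ b < m ] ν (α ⟨$⟩ʳ b) a
                    ≡⟨ cong₂ _-_ (∑-const m (M - 1ℤ)) (sym (∑-permute (λ b → ν b a) α)) ⟩
                  M * (M - 1ℤ) - ∑[ b < m ] ν b a
                    ≡⟨ cong (_-_ (M * (M - 1ℤ))) (trans (sum-cong-≗ (λ b → ν-sym b a)) (∑-ν-1 a)) ⟩
                  M * (M - 1ℤ) - (M - 1ℤ) ∎) ⟩
           (M * (M - 1ℤ) - (M - 1ℤ)) - (M - 1ℤ - ν (α ⟨$⟩ʳ a) a)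
             ≡⟨ collect M (ν (α ⟨$⟩ʳ a) a) ⟩
           (M - 1ℤ) * (M - + 2) + ν (α ⟨$⟩ʳ a) a ∎) ⟩
    ∑[ a < m ] ((M - 1ℤ) * (M - + 2) + ν (α ⟨$⟩ʳ a) a)
      ≡⟨ ∑-distrib-+ {m} (λ _ → (M - 1ℤ) * (M - + 2)) _ ⟩
    ∑[ a < m ] ((M - 1ℤ) * (M - + 2)) + ∑[ x < m ] ν (α ⟨$⟩ʳ x) x
      ≡⟨ cong (_+ ∑[ x < m ] ν (α ⟨$⟩ʳ x) x) (∑-const m ((M - 1ℤ) * (M - + 2))) ⟩
    M * ((M - 1ℤ) * (M - + 2)) + ∑[ x < m ] ν (α ⟨$⟩ʳ x) x ∎
    where
    collect : ∀ M v → (M * (M - 1ℤ) - (M - 1ℤ)) - (M - 1ℤ - v) ≡ (M - 1ℤ) * (M - + 2) + v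
    collect = solve-∀

  ∑-a : (f : Fin m → Fin m → Fin m) (g : Fin m → Fin m → Fin m → ℤ) →
    ∑³ (λ a b c → g a b c * δ a (f b c)) ≡ ∑[ b < m ] ∑[ c < m ] g (f b c) b c
  ∑-a f g = begin
    ∑³ (λ a b c → g a b c * δ a (f b c))
      ≡⟨ ∑-comm (λ a b → ∑[ c < m ] (g a b c * δ a (f b c))) ⟩
    ∑[ b < m ] ∑[ a < m ] ∑[ c < m ] (g a b c * δ a (f b c))
      ≡⟨ sum-cong-≗ (λ b → ∑-comm (λ a c → g a b c * δ a (f b c))) ⟩
    ∑[ b < m ] ∑[ c < m ] ∑[ a < m ] (g a b c * δ a (f b c))
      ≡⟨ sum-cong-≗ (λ b → sum-cong-≗ λ c → begin
           ∑[ a < m ] (g a b c * δ a (f b c))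
             ≡⟨ sum-cong-≗ (λ a → trans (ℤₚ.*-comm (g a b c) _) (cong (_* g a b c) (δ-sym a (f b c)))) ⟩
           ∑[ a < m ] (δ (f b c) a * g a b c)
             ≡⟨ ∑-δ (f b c) (λ a → g a b c) ⟩
           g (f b c) b c ∎) ⟩
    ∑[ b < m ] ∑[ c < m ] g (f b c) b c ∎

  S₁ : ∑³ (λ a b c → F a b c * δ a (β ⟨$⟩ʳ c)) ≡
       ∑[ x < m ] (ν (β ⟨$⟩ʳ x) x * (M - 1ℤ - ν (α ⟨$⟩ˡ x) (β ⟨$⟩ʳ x)))
  S₁ = begin
    ∑³ (λ a b c → F a b c * δ a (β ⟨$⟩ʳ c))
      ≡⟨ ∑-a (λ _ c → β ⟨$⟩ʳ c) F ⟩
    ∑[ b < m ] ∑[ c < m ] F (β ⟨$⟩ʳ c) b c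
      ≡⟨ ∑-comm (λ b c → F (β ⟨$⟩ʳ c) b c) ⟩
    ∑[ c < m ] ∑[ b < m ] F (β ⟨$⟩ʳ c) b c
      ≡⟨ sum-cong-≗ (λ c → begin
           ∑[ b < m ] F (β ⟨$⟩ʳ c) b c
             ≡⟨ sum-cong-≗ (λ b → trans (move (ν (β ⟨$⟩ʳ c) b) (ν (β ⟨$⟩ʳ c) c) (ν (α ⟨$⟩ʳ b) c)) (cong (λ v → ν (β ⟨$⟩ʳ c) c * (ν (β ⟨$⟩ʳ c) b * v))
                  (trans (ν-transpose α b c) (ν-sym b _)))) ⟩
           ∑[ b < m ] (ν (β ⟨$⟩ʳ c) c * (ν (β ⟨$⟩ʳ c) b * ν (α ⟨$⟩ˡ c) b))
             ≡⟨ *-distribˡ-sum {m} (ν (β ⟨$⟩ʳ c) c) _ ⟨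
           ν (β ⟨$⟩ʳ c) c * ∑[ b < m ] (ν (β ⟨$⟩ʳ c) b * ν (α ⟨$⟩ˡ c) b)
             ≡⟨ cong (ν (β ⟨$⟩ʳ c) c *_) (∑-ν² (β ⟨$⟩ʳ c) (α ⟨$⟩ˡ c)) ⟩
           ν (β ⟨$⟩ʳ c) c * (M - 1ℤ - ν (α ⟨$⟩ˡ c) (β ⟨$⟩ʳ c)) ∎) ⟩
    _ ∎
    where
    move : ∀ x y z → x * (y * z) ≡ y * (x * z)
    move = solve-∀

  S₂ : ∑³ (λ a b c → F a b c * δ a (γ ⟨$⟩ˡ b)) ≡
       ∑[ x < m ] (ν (γ ⟨$⟩ˡ x) x * (M - 1ℤ - ν (α ⟨$⟩ʳ x) (γ ⟨$⟩ˡ x)))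
  S₂ = begin
    ∑³ (λ a b c → F a b c * δ a (γ ⟨$⟩ˡ b))
      ≡⟨ ∑-a (λ b _ → γ ⟨$⟩ˡ b) F ⟩
    ∑[ b < m ] ∑[ c < m ] F (γ ⟨$⟩ˡ b) b c
      ≡⟨ sum-cong-≗ (λ b → begin
           ∑[ c < m ] F (γ ⟨$⟩ˡ b) b c
             ≡⟨ *-distribˡ-sum {m} (ν (γ ⟨$⟩ˡ b) b) _ ⟨
           ν (γ ⟨$⟩ˡ b) b * ∑[ c < m ] (ν (γ ⟨$⟩ˡ b) c * ν (α ⟨$⟩ʳ b) c)
             ≡⟨ cong (ν (γ ⟨$⟩ˡ b) b *_) (∑-ν² (γ ⟨$⟩ˡ b) (α ⟨$⟩ʳ b)) ⟩
           ν (γ ⟨$⟩ˡ b) b * (M - 1ℤ - ν (α ⟨$⟩ʳ b) (γ ⟨$⟩ˡ b)) ∎) ⟩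
    _ ∎

  δ-βγ : ∀ b c → δ (β ⟨$⟩ʳ c) (γ ⟨$⟩ˡ b) ≡ δ (β ⟨$⟩ˡ (γ ⟨$⟩ˡ b)) c
  δ-βγ b c = trans (δ-transpose β c _) (δ-sym c _)

  S₃ : ∑³ (λ a b c → F a b c * δ (γ ⟨$⟩ˡ b) (β ⟨$⟩ʳ c)) ≡
       ∑[ x < m ] (ν (α ⟨$⟩ʳ (γ ⟨$⟩ʳ x)) (β ⟨$⟩ˡ x) * (M - 1ℤ - ν (β ⟨$⟩ˡ x) (γ ⟨$⟩ʳ x)))
  S₃ = begin
    ∑³ (λ a b c → F a b c * δ (γ ⟨$⟩ˡ b) (β ⟨$⟩ʳ c))
      ≡⟨ sum-cong-≗ (λ a → sum-cong-≗ λ b → begin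
           ∑[ c < m ] (F a b c * δ (γ ⟨$⟩ˡ b) (β ⟨$⟩ʳ c))
             ≡⟨ sum-cong-≗ (λ c → trans (ℤₚ.*-comm (F a b c) _) (cong (_* F a b c)
                  (trans (δ-sym _ (β ⟨$⟩ʳ c)) (δ-βγ b c)))) ⟩
           ∑[ c < m ] (δ (η b) c * F a b c)
             ≡⟨ ∑-δ (η b) (F a b) ⟩
           F a b (η b) ∎) ⟩
    ∑[ a < m ] ∑[ b < m ] F a b (η b)
      ≡⟨ ∑-comm (λ a b → F a b (η b)) ⟩
    ∑[ b < m ] ∑[ a < m ] F a b (η b)
      ≡⟨ sum-cong-≗ (λ b → begin
           ∑[ a < m ] F a b (η b)
             ≡⟨ sum-cong-≗ (λ a → trans (move (ν a b) (ν a (η b)) (ν (α ⟨$⟩ʳ b) (η b)))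
                  (cong₂ (λ u v → ν (α ⟨$⟩ʳ b) (η b) * (u * v)) (ν-sym a b) (ν-sym a (η b)))) ⟩
           ∑[ a < m ] (ν (α ⟨$⟩ʳ b) (η b) * (ν b a * ν (η b) a))
             ≡⟨ *-distribˡ-sum {m} (ν (α ⟨$⟩ʳ b) (η b)) _ ⟨
           ν (α ⟨$⟩ʳ b) (η b) * ∑[ a < m ] (ν b a * ν (η b) a)
             ≡⟨ cong (ν (α ⟨$⟩ʳ b) (η b) *_) (∑-ν² b (η b)) ⟩
           ν (α ⟨$⟩ʳ b) (η b) * (M - 1ℤ - ν (η b) b) ∎) ⟩
    ∑[ b < m ] (ν (α ⟨$⟩ʳ b) (η b) * (M - 1ℤ - ν (η b) b))
      -- Substituting `γ x` for `b` moves the variable into part 3, where the first factor becomes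
      -- the one that occurs in `S₄`.
      ≡⟨ ∑-permute (λ b → ν (α ⟨$⟩ʳ b) (η b) * (M - 1ℤ - ν (η b) b)) γ ⟩
    ∑[ x < m ] (ν (α ⟨$⟩ʳ (γ ⟨$⟩ʳ x)) (η (γ ⟨$⟩ʳ x)) * (M - 1ℤ - ν (η (γ ⟨$⟩ʳ x)) (γ ⟨$⟩ʳ x)))
      ≡⟨ sum-cong-≗ (λ x → cong (λ y → ν (α ⟨$⟩ʳ (γ ⟨$⟩ʳ x)) y * (M - 1ℤ - ν y (γ ⟨$⟩ʳ x)))
           (cong (β ⟨$⟩ˡ_) (inverseˡ γ))) ⟩
    _ ∎
    where
    η : Fin m → Fin m
    η b = β ⟨$⟩ˡ (γ ⟨$⟩ˡ b)
    move : ∀ x y z → x * (y * z) ≡ z * (x * y)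
    move = solve-∀

  S₄ : ∑³ (λ a b c → F a b c * (δ a (β ⟨$⟩ʳ c) * δ a (γ ⟨$⟩ˡ b))) ≡
       ∑[ x < m ] (ν (γ ⟨$⟩ˡ x) x * (ν (β ⟨$⟩ʳ x) x * ν (α ⟨$⟩ʳ (γ ⟨$⟩ʳ x)) (β ⟨$⟩ˡ x)))
  S₄ = sum-cong-≗ λ a → begin
    ∑[ b < m ] ∑[ c < m ] (F a b c * (δ a (β ⟨$⟩ʳ c) * δ a (γ ⟨$⟩ˡ b)))
      ≡⟨ sum-cong-≗ (λ b → begin
           ∑[ c < m ] (F a b c * (δ a (β ⟨$⟩ʳ c) * δ a (γ ⟨$⟩ˡ b)))
             ≡⟨ sum-cong-≗ (λ c → trans
                  (cong₂ (λ u v → F a b c * (u * v))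
                    (trans (δ-sym a (β ⟨$⟩ʳ c)) (trans (δ-transpose β c a) (δ-sym c _)))
                    (sym (δ-transpose γ a b)))
                  (move (F a b c) (δ (β ⟨$⟩ˡ a) c) (δ (γ ⟨$⟩ʳ a) b))) ⟩
           ∑[ c < m ] (δ (β ⟨$⟩ˡ a) c * (δ (γ ⟨$⟩ʳ a) b * F a b c))
             ≡⟨ ∑-δ (β ⟨$⟩ˡ a) (λ c → δ (γ ⟨$⟩ʳ a) b * F a b c) ⟩
           δ (γ ⟨$⟩ʳ a) b * F a b (β ⟨$⟩ˡ a) ∎) ⟩
    ∑[ b < m ] (δ (γ ⟨$⟩ʳ a) b * F a b (β ⟨$⟩ˡ a))
      ≡⟨ ∑-δ (γ ⟨$⟩ʳ a) (λ b → F a b (β ⟨$⟩ˡ a)) ⟩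
    F a (γ ⟨$⟩ʳ a) (β ⟨$⟩ˡ a)
      ≡⟨ cong₂ (λ u v → u * (v * ν (α ⟨$⟩ʳ (γ ⟨$⟩ʳ a)) (β ⟨$⟩ˡ a)))
           (trans (ν-sym a _) (trans (ν-transpose γ a a) (ν-sym a _)))
           (sym (ν-transpose β a a)) ⟩
    _ ∎
    where
    move : ∀ f x y → f * (x * y) ≡ x * (y * f)
    move = solve-∀

  colorings≡ : colorings ≡ (M - + 3) * (M * ((M - 1ℤ) * (M - + 2))) + sum G
  colorings≡ = begin
    colorings
      ≡⟨ ∑³-cong (λ a b c → trans
           (cong (F a b c *_) (∑-ν³ a (β ⟨$⟩ʳ c) (γ ⟨$⟩ˡ b)))
           (expand M (F a b c) (δ (γ ⟨$⟩ˡ b) (β ⟨$⟩ʳ c)) (δ a (β ⟨$⟩ʳ c)) (δ a (γ ⟨$⟩ˡ b)))) ⟩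
    ∑³ (λ a b c → (M - + 3) * F a b c + F a b c * δ a (β ⟨$⟩ʳ c) + F a b c * δ a (γ ⟨$⟩ˡ b)
                  + F a b c * δ (γ ⟨$⟩ˡ b) (β ⟨$⟩ʳ c) - F a b c * (δ a (β ⟨$⟩ʳ c) * δ a (γ ⟨$⟩ˡ b)))
      ≡⟨ trans (∑³-distrib-- {m} _ _) (cong₂ _-_
           (trans (∑³-distrib-+ {m} _ _) (cong₂ _+_
             (trans (∑³-distrib-+ {m} _ _) (cong₂ _+_
               (trans (∑³-distrib-+ {m} _ _) (cong₂ _+_ scale S₁)) S₂)) S₃)) S₄) ⟩
    (M - + 3) * (M * ((M - 1ℤ) * (M - + 2)) + s₀) + s₁ + s₂ + s₃ - s₄
      ≡⟨ regroup (M - + 3) (M * ((M - 1ℤ) * (M - + 2))) s₀ s₁ s₂ s₃ s₄ ⟩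
    (M - + 3) * (M * ((M - 1ℤ) * (M - + 2))) + ((M - + 3) * s₀ + s₁ + s₂ + s₃ - s₄)
      ≡⟨ cong (_+_ ((M - + 3) * (M * ((M - 1ℤ) * (M - + 2))))) merge ⟨
    (M - + 3) * (M * ((M - 1ℤ) * (M - + 2))) + sum G ∎
    where
    s₀ = ∑[ x < m ] ν (α ⟨$⟩ʳ x) x
    s₁ = ∑[ x < m ] (ν (β ⟨$⟩ʳ x) x * (M - 1ℤ - ν (α ⟨$⟩ˡ x) (β ⟨$⟩ʳ x)))
    s₂ = ∑[ x < m ] (ν (γ ⟨$⟩ˡ x) x * (M - 1ℤ - ν (α ⟨$⟩ʳ x) (γ ⟨$⟩ˡ x)))
    s₃ = ∑[ x < m ] (ν (α ⟨$⟩ʳ (γ ⟨$⟩ʳ x)) (β ⟨$⟩ˡ x) * (M - 1ℤ - ν (β ⟨$⟩ˡ x) (γ ⟨$⟩ʳ x)))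
    s₄ = ∑[ x < m ] (ν (γ ⟨$⟩ˡ x) x * (ν (β ⟨$⟩ʳ x) x * ν (α ⟨$⟩ʳ (γ ⟨$⟩ʳ x)) (β ⟨$⟩ˡ x)))
    expand : ∀ M f p q r → f * ((M - + 3) + p + q + r - q * r) ≡
             (M - + 3) * f + f * q + f * r + f * p - f * (q * r)
    expand = solve-∀
    regroup : ∀ k c s₀ s₁ s₂ s₃ s₄ → k * (c + s₀) + s₁ + s₂ + s₃ - s₄ ≡ k * c + (k * s₀ + s₁ + s₂ + s₃ - s₄)
    regroup = solve-∀
    scale : ∑³ (λ a b c → (M - + 3) * F a b c) ≡ (M - + 3) * (M * ((M - 1ℤ) * (M - + 2)) + s₀)
    scale = begin
      ∑³ (λ a b c → (M - + 3) * F a b c)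
        ≡⟨ sum-cong-≗ (λ a → trans (sum-cong-≗ λ b → sym (*-distribˡ-sum (M - + 3) (F a b)))
             (sym (*-distribˡ-sum {m} (M - + 3) _))) ⟩
      ∑[ a < m ] ((M - + 3) * ∑[ b < m ] ∑[ c < m ] F a b c)
        ≡⟨ *-distribˡ-sum {m} (M - + 3) _ ⟨
      (M - + 3) * ∑³ F
        ≡⟨ cong ((M - + 3) *_) S₀ ⟩
      _ ∎
    merge : sum G ≡ (M - + 3) * s₀ + s₁ + s₂ + s₃ - s₄
    merge = trans (∑-distrib-- {m} _ _) (cong (_- s₄)
      (trans (∑-distrib-+ {m} _ _) (cong (_+ s₃)
        (trans (∑-distrib-+ {m} _ _) (cong (_+ s₂)
          (trans (∑-distrib-+ {m} _ _) (cong (_+ s₁)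
            (sym (*-distribˡ-sum (M - + 3) (λ x → ν (α ⟨$⟩ʳ x) x))))))))))

-- Inequalities between indicators, and the points where permutations differ

ι-yes : ∀ {A : Set} (a? : Dec A) → A → ι a? ≡ 1ℤ
ι-yes a? a rewrite dec-true a? a = refl

ι-no : ∀ {A : Set} (a? : Dec A) → ¬ A → ι a? ≡ 0ℤ
ι-no a? ¬a rewrite dec-false a? ¬a = refl

δ-≡ : {i j : Fin m} → i ≡ j → δ i j ≡ 1ℤ
δ-≡ {i = i} {j} = ι-yes (i ≟ᶠ j)

δ-≢ : {i j : Fin m} → i ≢ j → δ i j ≡ 0ℤ
δ-≢ {i = i} {j} = ι-no (i ≟ᶠ j)

ν-≡ : {i j : Fin m} → i ≡ j → ν i j ≡ 0ℤ
ν-≡ = cong (_-_ 1ℤ) ∘ δ-≡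

ν-≢ : {i j : Fin m} → i ≢ j → ν i j ≡ 1ℤ
ν-≢ = cong (_-_ 1ℤ) ∘ δ-≢

0≤δ : (i j : Fin m) → 0ℤ ≤ᶻ δ i j
0≤δ i j with i ≟ᶠ j
... | yes _ = +≤+ z≤n
... | no  _ = +≤+ z≤n

0≤ν : (i j : Fin m) → 0ℤ ≤ᶻ ν i j
0≤ν i j with i ≟ᶠ j
... | yes _ = +≤+ z≤n
... | no  _ = +≤+ z≤n

infixl 6 _⊕_
infixl 7 _⊗_

_⊕_ : ∀ {i j} → 0ℤ ≤ᶻ i → 0ℤ ≤ᶻ j → 0ℤ ≤ᶻ i + j
_⊕_ = ℤₚ.+-mono-≤

_⊗_ : ∀ {i j} → 0ℤ ≤ᶻ i → 0ℤ ≤ᶻ j → 0ℤ ≤ᶻ i * j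
_⊗_ {+ i} {+ j} _ _ = subst (0ℤ ≤ᶻ_) (ℤₚ.pos-* i j) (+≤+ z≤n)

∑-mono-≤ : {f g : Fin m → ℤ} → (∀ i → f i ≤ᶻ g i) → sum f ≤ᶻ sum g
∑-mono-≤ {zero}  f≤g = ℤₚ.≤-refl
∑-mono-≤ {suc m} f≤g = ℤₚ.+-mono-≤ (f≤g zero) (∑-mono-≤ (f≤g ∘ suc))

0≤∑ : {f : Fin m → ℤ} → (∀ i → 0ℤ ≤ᶻ f i) → 0ℤ ≤ᶻ sum f
0≤∑ {zero}  0≤f = ℤₚ.≤-refl
0≤∑ {suc m} 0≤f = 0≤f zero ⊕ 0≤∑ (0≤f ∘ suc)

module _ {m} (f g : Fin m → Fin m) where
  disagreement : ℤ
  disagreement = ∑[ x < m ] ν (f x) (g x)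

  -- Each `δ` sums to 1, and since the points are distinct the two of them together stay below the
  -- indicator of disagreement.
  two≤disagreement : ∀ {x y} → x ≢ y → f x ≢ g x → f y ≢ g y → + 2 ≤ᶻ disagreement
  two≤disagreement {x} {y} x≢y fx≢gx fy≢gy = begin
    + 2                                   ≡⟨ cong₂ _+_ (∑-δ-1 x) (∑-δ-1 y) ⟨
    ∑[ z < m ] δ x z + ∑[ z < m ] δ y z   ≡⟨ ∑-distrib-+ (δ x) (δ y) ⟨
    ∑[ z < m ] (δ x z + δ y z)            ≤⟨ ∑-mono-≤ pointwise ⟩
    disagreement                          ∎
    where
    open ℤₚ.≤-Reasoning
    pointwise : ∀ z → δ x z + δ y z ≤ᶻ ν (f z) (g z)
    pointwise z with x ≟ᶠ z | y ≟ᶠ z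
    ... | yes refl | yes refl = contradiction refl x≢y
    ... | yes refl | no _     = ℤₚ.≤-reflexive (sym (ν-≢ fx≢gx))
    ... | no _     | yes refl = ℤₚ.≤-reflexive (sym (ν-≢ fy≢gy))
    ... | no _     | no _     = 0≤ν (f z) (g z)

  three≤disagreement : ∀ {x y w} → x ≢ y → x ≢ w → y ≢ w →
    f x ≢ g x → f y ≢ g y → f w ≢ g w → + 3 ≤ᶻ disagreement
  three≤disagreement {x} {y} {w} x≢y x≢w y≢w fx≢gx fy≢gy fw≢gw = begin
    + 3                                        ≡⟨ cong₂ _+_ (cong₂ _+_ (∑-δ-1 x) (∑-δ-1 y)) (∑-δ-1 w) ⟨
    sum (δ x) + sum (δ y) + sum (δ w)          ≡⟨ cong (_+ sum (δ w)) (∑-distrib-+ (δ x) (δ y)) ⟨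
    ∑[ z < m ] (δ x z + δ y z) + sum (δ w)     ≡⟨ ∑-distrib-+ (λ z → δ x z + δ y z) (δ w) ⟨
    ∑[ z < m ] (δ x z + δ y z + δ w z)         ≤⟨ ∑-mono-≤ pointwise ⟩
    disagreement                               ∎
    where
    open ℤₚ.≤-Reasoning
    pointwise : ∀ z → δ x z + δ y z + δ w z ≤ᶻ ν (f z) (g z)
    pointwise z with x ≟ᶠ z | y ≟ᶠ z | w ≟ᶠ z
    ... | yes refl | yes refl | _        = contradiction refl x≢y
    ... | yes refl | _        | yes refl = contradiction refl x≢w
    ... | _        | yes refl | yes refl = contradiction refl y≢w
    ... | yes refl | no _     | no _     = ℤₚ.≤-reflexive (sym (ν-≢ fx≢gx))
    ... | no _     | yes refl | no _     = ℤₚ.≤-reflexive (sym (ν-≢ fy≢gy))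
    ... | no _     | no _     | yes refl = ℤₚ.≤-reflexive (sym (ν-≢ fw≢gw))
    ... | no _     | no _     | no _     = 0≤ν (f z) (g z)

  0≤disagreement : 0ℤ ≤ᶻ disagreement
  0≤disagreement = 0≤∑ λ x → 0≤ν (f x) (g x)

injectiveʳ : (π : Permutation′ m) {x y : Fin m} → π ⟨$⟩ʳ x ≡ π ⟨$⟩ʳ y → x ≡ y
injectiveʳ π πx≡πy = trans (sym (inverseˡ π)) (trans (cong (π ⟨$⟩ˡ_) πx≡πy) (inverseˡ π))

-- The value `ρ x`, which `π` does not take at x, is taken by `π` at another point y, and `ρ` cannot
-- take it there a second time.
permutations-disagree-twice : (π ρ : Permutation′ m) {x : Fin m} → π ⟨$⟩ʳ x ≢ ρ ⟨$⟩ʳ x →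
  + 2 ≤ᶻ disagreement (π ⟨$⟩ʳ_) (ρ ⟨$⟩ʳ_)
permutations-disagree-twice π ρ {x} πx≢ρx = two≤disagreement (π ⟨$⟩ʳ_) (ρ ⟨$⟩ʳ_) x≢y πx≢ρx πy≢ρy
  where
  y = π ⟨$⟩ˡ (ρ ⟨$⟩ʳ x)
  πy≡ρx : π ⟨$⟩ʳ y ≡ ρ ⟨$⟩ʳ x
  πy≡ρx = inverseʳ π
  x≢y : x ≢ y
  x≢y x≡y = πx≢ρx (trans (cong (π ⟨$⟩ʳ_) x≡y) πy≡ρx)
  πy≢ρy : π ⟨$⟩ʳ y ≢ ρ ⟨$⟩ʳ y
  πy≢ρy πy≡ρy = x≢y (injectiveʳ ρ (trans (sym πy≡ρx) πy≡ρy))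

-- The hypothesis says that the orbit of x under `π` has length at least 3. Every point of such an
-- orbit disagrees, and x with its two neighbours are three of them.
inverse-disagrees-thrice : (π : Permutation′ m) {x : Fin m} → π ⟨$⟩ʳ x ≢ π ⟨$⟩ˡ x →
  + 3 ≤ᶻ disagreement (π ⟨$⟩ʳ_) (π ⟨$⟩ˡ_)
inverse-disagrees-thrice π {x} πx≢π⁻x = three≤disagreement (π ⟨$⟩ʳ_) (π ⟨$⟩ˡ_)
  {x} {π ⟨$⟩ʳ x} {π ⟨$⟩ˡ x}
  (λ x≡πx → πx≢π⁻x (trans (sym x≡πx) (trans (sym (inverseˡ π)) (cong (π ⟨$⟩ˡ_) (sym x≡πx)))))
  (λ x≡π⁻x → πx≢π⁻x (trans (cong (π ⟨$⟩ʳ_) x≡π⁻x) (trans (inverseʳ π) x≡π⁻x)))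
  πx≢π⁻x
  πx≢π⁻x
  (λ ππx≡π⁻πx → πx≢π⁻x (trans (sym (inverseˡ π)) (cong (π ⟨$⟩ˡ_) (trans ππx≡π⁻πx (inverseˡ π)))))
  (λ ππ⁻x≡π⁻π⁻x → πx≢π⁻x (trans (cong (π ⟨$⟩ʳ_) (trans (sym (inverseʳ π)) ππ⁻x≡π⁻π⁻x)) (inverseʳ π)))

-- The points split into those moved up and those moved down, and the involution exchanges the two classes.
fixedPointFree⇒even : (π : Permutation′ m) → (∀ x → π ⟨$⟩ʳ (π ⟨$⟩ʳ x) ≡ x) →
  (∀ x → π ⟨$⟩ʳ x ≢ x) → 2 ∣ m
fixedPointFree⇒even {m} π ππ≡id π≢id = divides ∣ up ∣ᶻ (begin
  m                    ≡⟨ cong ∣_∣ᶻ +m≡up*2 ⟩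
  ∣ up * + 2 ∣ᶻ         ≡⟨ ℤₚ.abs-* up (+ 2) ⟩
  ∣ up ∣ᶻ ℕ.* 2         ∎)
  where
  open ≡-Reasoning
  up = ∑[ x < m ] ι (x <? π ⟨$⟩ʳ x)
  split : ∀ x → ι (x <? π ⟨$⟩ʳ x) + ι (π ⟨$⟩ʳ x <? x) ≡ 1ℤ
  split x with <-cmp x (π ⟨$⟩ʳ x)
  ... | tri< x<πx _ πx≮x = cong₂ _+_ (ι-yes (x <? π ⟨$⟩ʳ x) x<πx) (ι-no (π ⟨$⟩ʳ x <? x) πx≮x)
  ... | tri≈ _ x≡πx _    = contradiction (sym x≡πx) (π≢id x)
  ... | tri> x≮πx _ πx<x = cong₂ _+_ (ι-no (x <? π ⟨$⟩ʳ x) x≮πx) (ι-yes (π ⟨$⟩ʳ x <? x) πx<x)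
  +m≡up*2 : + m ≡ up * + 2
  +m≡up*2 = begin
    + m
      ≡⟨ trans (∑-const m 1ℤ) (ℤₚ.*-identityʳ (+ m)) ⟨
    ∑[ x < m ] 1ℤ
      ≡⟨ sum-cong-≗ split ⟨
    ∑[ x < m ] (ι (x <? π ⟨$⟩ʳ x) + ι (π ⟨$⟩ʳ x <? x))
      ≡⟨ ∑-distrib-+ (λ x → ι (x <? π ⟨$⟩ʳ x)) (λ x → ι (π ⟨$⟩ʳ x <? x)) ⟩
    up + ∑[ x < m ] ι (π ⟨$⟩ʳ x <? x)
      ≡⟨ cong (_+_ up) (∑-permute (λ x → ι (π ⟨$⟩ʳ x <? x)) π) ⟩
    up + ∑[ x < m ] ι (π ⟨$⟩ʳ (π ⟨$⟩ʳ x) <? π ⟨$⟩ʳ x)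
      ≡⟨ cong (_+_ up) (sum-cong-≗ (λ x → cong (λ y → ι (y <? π ⟨$⟩ʳ x)) (ππ≡id x))) ⟩
    up + up
      ≡⟨ double up ⟩
    up * + 2 ∎
    where
    double : ∀ u → u + u ≡ u * + 2
    double = solve-∀

-- The deficiency and the upper bounds

quartic : ℤ → ℤ
quartic M = M * (M * (M * (M - + 6) + + 15) - + 13)

inverse-cong : (π ρ : Permutation′ m) → (∀ x → π ⟨$⟩ʳ x ≡ ρ ⟨$⟩ʳ x) → ∀ x → π ⟨$⟩ˡ x ≡ ρ ⟨$⟩ˡ x
inverse-cong π ρ π≗ρ x = injectiveʳ ρ (trans (sym (π≗ρ (π ⟨$⟩ˡ x))) (trans (inverseʳ π) (sym (inverseʳ ρ))))

unequal⇒2≤disagreement : (π ρ : Permutation′ m) → ¬ (∀ x → π ⟨$⟩ʳ x ≡ ρ ⟨$⟩ʳ x) → + 2 ≤ᶻ disagreement (π ⟨$⟩ʳ_) (ρ ⟨$⟩ʳ_)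
unequal⇒2≤disagreement {m} π ρ π≇ρ with x , πx≢ρx ← ¬∀⟶∃¬ m _ (λ x → π ⟨$⟩ʳ x ≟ᶠ ρ ⟨$⟩ʳ x) π≇ρ = permutations-disagree-twice π ρ πx≢ρx

unequal-inverse⇒3≤disagreement : (π ρ : Permutation′ m) → ¬ (∀ x → π ⟨$⟩ʳ x ≡ ρ ⟨$⟩ʳ x) → (∀ x → ρ ⟨$⟩ʳ x ≡ π ⟨$⟩ˡ x) →
  + 3 ≤ᶻ disagreement (π ⟨$⟩ʳ_) (ρ ⟨$⟩ʳ_)
unequal-inverse⇒3≤disagreement {m} π ρ π≇ρ ρ≗π⁻ with x , πx≢ρx ← ¬∀⟶∃¬ m _ (λ x → π ⟨$⟩ʳ x ≟ᶠ ρ ⟨$⟩ʳ x) π≇ρ =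
  subst (+ 3 ≤ᶻ_) (sum-cong-≗ (λ y → cong (ν (π ⟨$⟩ʳ y)) (sym (ρ≗π⁻ y))))
    (inverse-disagrees-thrice π (λ πx≡π⁻x → πx≢ρx (trans πx≡π⁻x (sym (ρ≗π⁻ x)))))

module Deficiency {m} (α β γ : Permutation′ m) where
  open Count α β γ

  -- The tᵢ indicate the triangles of the cover over the four triangles of K₄; the sᵢ indicate the closed
  -- lifts, and the wᵢ the lifts that are not closed, of its three 4-cycles.
  t₀ t₁ t₂ t₃ s₁ s₂ s₃ w₁ w₂ w₃ : Fin m → ℤ
  t₀ x = δ (α ⟨$⟩ʳ x) x
  t₁ x = δ (β ⟨$⟩ʳ x) x
  t₂ x = δ (γ ⟨$⟩ˡ x) x
  t₃ x = δ (α ⟨$⟩ʳ (γ ⟨$⟩ʳ x)) (β ⟨$⟩ˡ x)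
  s₁ x = δ (α ⟨$⟩ˡ x) (β ⟨$⟩ʳ x)
  s₂ x = δ (α ⟨$⟩ʳ x) (γ ⟨$⟩ˡ x)
  s₃ x = δ (β ⟨$⟩ˡ x) (γ ⟨$⟩ʳ x)
  w₁ x = ν (α ⟨$⟩ˡ x) (β ⟨$⟩ʳ x)
  w₂ x = ν (α ⟨$⟩ʳ x) (γ ⟨$⟩ˡ x)
  w₃ x = ν (β ⟨$⟩ˡ x) (γ ⟨$⟩ʳ x)

  -- For m ≥ 3 the three summands have separate tasks: `cycles` measures nontrivial monodromy,
  -- `both` detects a common fixed point, and `rest` only has to be nonnegative. The last bracket of
  -- `rest` is the number of pairs among t₁, t₂, t₃ minus their triple product, arranged so that
  -- every term is visibly nonnegative.
  cycles both rest deficiency : Fin m → ℤ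
  cycles x = w₁ x + w₂ x + w₃ x
  both x = t₁ x * s₁ x + t₂ x * s₂ x + t₃ x * s₃ x
  rest x = (M - + 3) * (t₀ x + t₁ x + t₂ x + t₃ x)
         + (t₁ x * t₂ x * (1ℤ - t₃ x) + t₁ x * t₃ x + t₂ x * t₃ x)
  deficiency x = cycles x + both x + rest x

  -- The constant is (M - 3) + 3 (M - 1) - 1, the value of `G x` when every tᵢ is 0 and every sᵢ is
  -- 1. The identity holds for arbitrary integers in place of the indicators.
  G+deficiency : ∀ x → G x + deficiency x ≡ + 4 * M - + 7
  G+deficiency x = identity M (t₀ x) (t₁ x) (t₂ x) (t₃ x) (s₁ x) (s₂ x) (s₃ x)
    where
    identity : ∀ M t₀ t₁ t₂ t₃ s₁ s₂ s₃ →
      ((M - + 3) * (1ℤ - t₀) + (1ℤ - t₁) * (M - 1ℤ - (1ℤ - s₁)) + (1ℤ - t₂) * (M - 1ℤ - (1ℤ - s₂))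
        + (1ℤ - t₃) * (M - 1ℤ - (1ℤ - s₃)) - (1ℤ - t₂) * ((1ℤ - t₁) * (1ℤ - t₃)))
      + ((1ℤ - s₁) + (1ℤ - s₂) + (1ℤ - s₃) + (t₁ * s₁ + t₂ * s₂ + t₃ * s₃)
        + ((M - + 3) * (t₀ + t₁ + t₂ + t₃) + (t₁ * t₂ * (1ℤ - t₃) + t₁ * t₃ + t₂ * t₃)))
      ≡ + 4 * M - + 7
    identity = solve-∀

  colorings+deficiency : colorings + sum deficiency ≡ quartic M
  colorings+deficiency = begin
    colorings + sum deficiency
      ≡⟨ cong (_+ sum deficiency) colorings≡ ⟩
    (M - + 3) * (M * ((M - 1ℤ) * (M - + 2))) + sum G + sum deficiency
      ≡⟨ ℤₚ.+-assoc ((M - + 3) * (M * ((M - 1ℤ) * (M - + 2)))) (sum G) (sum deficiency) ⟩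
    (M - + 3) * (M * ((M - 1ℤ) * (M - + 2))) + (sum G + sum deficiency)
      ≡⟨ cong (_+_ ((M - + 3) * (M * ((M - 1ℤ) * (M - + 2)))))
           (trans (sym (∑-distrib-+ G deficiency))
             (trans (sum-cong-≗ G+deficiency) (∑-const m (+ 4 * M - + 7)))) ⟩
    (M - + 3) * (M * ((M - 1ℤ) * (M - + 2))) + M * (+ 4 * M - + 7)
      ≡⟨ collect M ⟩
    quartic M ∎
    where
    open ≡-Reasoning
    collect : ∀ M → (M - + 3) * (M * ((M - 1ℤ) * (M - + 2))) + M * (+ 4 * M - + 7)
                  ≡ M * (M * (M * (M - + 6) + + 15) - + 13)
    collect = solve-∀

  colorings≤ : ∀ {k} → k ≤ᶻ sum deficiency → colorings + k ≤ᶻ quartic M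
  colorings≤ k≤ = subst (colorings + _ ≤ᶻ_) colorings+deficiency (ℤₚ.+-monoʳ-≤ colorings k≤)

  0≤cycles : ∀ x → 0ℤ ≤ᶻ cycles x
  0≤cycles x = 0≤ν (α ⟨$⟩ˡ x) (β ⟨$⟩ʳ x) ⊕ 0≤ν (α ⟨$⟩ʳ x) (γ ⟨$⟩ˡ x) ⊕ 0≤ν (β ⟨$⟩ˡ x) (γ ⟨$⟩ʳ x)

  0≤t₀ : ∀ x → 0ℤ ≤ᶻ t₀ x
  0≤t₀ x = 0≤δ (α ⟨$⟩ʳ x) x

  0≤t₁ : ∀ x → 0ℤ ≤ᶻ t₁ x
  0≤t₁ x = 0≤δ (β ⟨$⟩ʳ x) x

  0≤t₂ : ∀ x → 0ℤ ≤ᶻ t₂ x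
  0≤t₂ x = 0≤δ (γ ⟨$⟩ˡ x) x

  0≤t₃ : ∀ x → 0ℤ ≤ᶻ t₃ x
  0≤t₃ x = 0≤δ (α ⟨$⟩ʳ (γ ⟨$⟩ʳ x)) (β ⟨$⟩ˡ x)

  0≤both : ∀ x → 0ℤ ≤ᶻ both x
  0≤both x = 0≤t₁ x ⊗ 0≤δ (α ⟨$⟩ˡ x) (β ⟨$⟩ʳ x)
           ⊕ 0≤t₂ x ⊗ 0≤δ (α ⟨$⟩ʳ x) (γ ⟨$⟩ˡ x)
           ⊕ 0≤t₃ x ⊗ 0≤δ (β ⟨$⟩ˡ x) (γ ⟨$⟩ʳ x)

  module _ (3≤m : 3 ≤ m) where
    0≤M-3 : 0ℤ ≤ᶻ M - + 3
    0≤M-3 = ℤₚ.i≤j⇒0≤j-i (+≤+ 3≤m)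

    0≤rest : ∀ x → 0ℤ ≤ᶻ rest x
    0≤rest x = 0≤M-3 ⊗ (0≤t₀ x ⊕ 0≤t₁ x ⊕ 0≤t₂ x ⊕ 0≤t₃ x)
             ⊕ (0≤t₁ x ⊗ 0≤t₂ x ⊗ 0≤ν (α ⟨$⟩ʳ (γ ⟨$⟩ʳ x)) (β ⟨$⟩ˡ x) ⊕ 0≤t₁ x ⊗ 0≤t₃ x ⊕ 0≤t₂ x ⊗ 0≤t₃ x)

    0≤∑deficiency : 0ℤ ≤ᶻ sum deficiency
    0≤∑deficiency = 0≤∑ λ x → 0≤cycles x ⊕ 0≤both x ⊕ 0≤rest x

    deficiency≥cycles : disagreement (α ⟨$⟩ˡ_) (β ⟨$⟩ʳ_) + disagreement (α ⟨$⟩ʳ_) (γ ⟨$⟩ˡ_)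
      + disagreement (β ⟨$⟩ˡ_) (γ ⟨$⟩ʳ_) ≤ᶻ sum deficiency
    deficiency≥cycles = begin
      sum w₁ + sum w₂ + sum w₃             ≡⟨ cong (_+ sum w₃) (∑-distrib-+ w₁ w₂) ⟨
      ∑[ x < m ] (w₁ x + w₂ x) + sum w₃    ≡⟨ ∑-distrib-+ (λ x → w₁ x + w₂ x) w₃ ⟨
      sum cycles                           ≤⟨ ∑-mono-≤ (λ x → ℤₚ.≤-trans (ℤₚ.≤-reflexive (sym (trans (ℤₚ.+-identityʳ _) (ℤₚ.+-identityʳ _))))
                                                (ℤₚ.+-mono-≤ (ℤₚ.+-monoʳ-≤ (cycles x) (0≤both x)) (0≤rest x))) ⟩
      sum deficiency                       ∎
      where open ℤₚ.≤-Reasoning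

    deficiency≥both : ∀ {x} → + 3 ≤ᶻ both x → + 3 ≤ᶻ sum deficiency
    deficiency≥both {x} 3≤both = begin
      + 3                          ≡⟨ cong (_*_ (+ 3)) (∑-δ-1 x) ⟨
      + 3 * sum (δ x)              ≡⟨ *-distribˡ-sum (+ 3) (δ x) ⟩
      ∑[ y < m ] (+ 3 * δ x y)     ≤⟨ ∑-mono-≤ pointwise ⟩
      sum deficiency               ∎
      where
      open ℤₚ.≤-Reasoning
      pointwise : ∀ y → + 3 * δ x y ≤ᶻ deficiency y
      pointwise y with x ≟ᶠ y
      ... | yes refl = ℤₚ.+-mono-≤ (ℤₚ.+-mono-≤ (0≤cycles x) 3≤both) (0≤rest x)
      ... | no  _    = 0≤cycles y ⊕ 0≤both y ⊕ 0≤rest y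

    cycles-bound : ∀ {a b c} → a ≤ᶻ disagreement (α ⟨$⟩ˡ_) (β ⟨$⟩ʳ_) → b ≤ᶻ disagreement (α ⟨$⟩ʳ_) (γ ⟨$⟩ˡ_) →
      c ≤ᶻ disagreement (β ⟨$⟩ˡ_) (γ ⟨$⟩ʳ_) → a + b + c ≤ᶻ sum deficiency
    cycles-bound a≤ b≤ c≤ = ℤₚ.≤-trans (ℤₚ.+-mono-≤ (ℤₚ.+-mono-≤ a≤ b≤) c≤) deficiency≥cycles

    -- Here x gives a copy of K₄ in the cover.
    fixedPoint⇒3≤∑deficiency : (∀ x → α ⟨$⟩ˡ x ≡ β ⟨$⟩ʳ x) → (∀ x → α ⟨$⟩ʳ x ≡ γ ⟨$⟩ˡ x) →
      ∀ {x} → α ⟨$⟩ʳ x ≡ x → + 3 ≤ᶻ sum deficiency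
    fixedPoint⇒3≤∑deficiency α⁻≗β α≗γ⁻ {x} αx≡x = deficiency≥both (ℤₚ.≤-reflexive (sym (begin
      both x
        ≡⟨ cong₂ _+_ (cong₂ _+_
             (cong₂ _*_ (δ-≡ βx≡x) (δ-≡ (α⁻≗β x)))
             (cong₂ _*_ (δ-≡ γ⁻x≡x) (δ-≡ (α≗γ⁻ x))))
             (cong₂ _*_ (δ-≡ (trans (cong (α ⟨$⟩ʳ_) γx≡x) (trans αx≡x (sym β⁻x≡x)))) (δ-≡ (trans β⁻x≡x (sym γx≡x)))) ⟩
      + 3 ∎)))
      where
      open ≡-Reasoning
      βx≡x : β ⟨$⟩ʳ x ≡ x
      βx≡x = trans (sym (α⁻≗β x)) (trans (cong (α ⟨$⟩ˡ_) (sym αx≡x)) (inverseˡ α))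
      γ⁻x≡x : γ ⟨$⟩ˡ x ≡ x
      γ⁻x≡x = trans (sym (α≗γ⁻ x)) αx≡x
      γx≡x : γ ⟨$⟩ʳ x ≡ x
      γx≡x = trans (cong (γ ⟨$⟩ʳ_) (sym γ⁻x≡x)) (inverseʳ γ)
      β⁻x≡x : β ⟨$⟩ˡ x ≡ x
      β⁻x≡x = trans (cong (β ⟨$⟩ˡ_) (sym βx≡x)) (inverseˡ β)

    3≤∑deficiency : ¬ 2 ∣ m → + 3 ≤ᶻ sum deficiency
    3≤∑deficiency 2∤m
      with all? (λ x → α ⟨$⟩ˡ x ≟ᶠ β ⟨$⟩ʳ x) | all? (λ x → α ⟨$⟩ʳ x ≟ᶠ γ ⟨$⟩ˡ x) | all? (λ x → β ⟨$⟩ˡ x ≟ᶠ γ ⟨$⟩ʳ x)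
    -- Two failures cost 2 + 2, one more than required.
    ... | no p | no q | _ = ℤₚ.≤-trans (+≤+ (ℕₚ.m≤m+n 3 1)) (cycles-bound
            (unequal⇒2≤disagreement (flip α) β p) (unequal⇒2≤disagreement α (flip γ) q) (0≤disagreement (β ⟨$⟩ˡ_) (γ ⟨$⟩ʳ_)))
    ... | no p | yes _ | no r = ℤₚ.≤-trans (+≤+ (ℕₚ.m≤m+n 3 1)) (cycles-bound
            (unequal⇒2≤disagreement (flip α) β p) (0≤disagreement (α ⟨$⟩ʳ_) (γ ⟨$⟩ˡ_)) (unequal⇒2≤disagreement (flip β) γ r))
    ... | yes _ | no q | no r = ℤₚ.≤-trans (+≤+ (ℕₚ.m≤m+n 3 1)) (cycles-bound
            (0≤disagreement (α ⟨$⟩ˡ_) (β ⟨$⟩ʳ_)) (unequal⇒2≤disagreement α (flip γ) q) (unequal⇒2≤disagreement (flip β) γ r))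
    -- The two agreements that hold make both sides of the third inverse to each other: here `β`
    -- agrees with `α`, the inverse of `flip α`. The next two cases are alike.
    ... | no p | yes α≗γ⁻ | yes β⁻≗γ = cycles-bound
            (unequal-inverse⇒3≤disagreement (flip α) β p (λ x → sym (trans (α≗γ⁻ x) (inverse-cong γ (flip β) (sym ∘ β⁻≗γ) x))))
            (0≤disagreement (α ⟨$⟩ʳ_) (γ ⟨$⟩ˡ_)) (0≤disagreement (β ⟨$⟩ˡ_) (γ ⟨$⟩ʳ_))
    ... | yes α⁻≗β | no q | yes β⁻≗γ = cycles-bound
            (0≤disagreement (α ⟨$⟩ˡ_) (β ⟨$⟩ʳ_))
            (unequal-inverse⇒3≤disagreement α (flip γ) q (λ x → sym (trans (α⁻≗β x) (sym (inverse-cong γ (flip β) (sym ∘ β⁻≗γ) x)))))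
            (0≤disagreement (β ⟨$⟩ˡ_) (γ ⟨$⟩ʳ_))
    ... | yes α⁻≗β | yes α≗γ⁻ | no r = cycles-bound
            (0≤disagreement (α ⟨$⟩ˡ_) (β ⟨$⟩ʳ_)) (0≤disagreement (α ⟨$⟩ʳ_) (γ ⟨$⟩ˡ_))
            (unequal-inverse⇒3≤disagreement (flip β) γ r (λ x → trans (sym (inverse-cong α (flip γ) α≗γ⁻ x)) (α⁻≗β x)))
    ... | yes α⁻≗β | yes α≗γ⁻ | yes β⁻≗γ with any? (λ x → α ⟨$⟩ʳ x ≟ᶠ x)
    ...   | yes (x , αx≡x) = fixedPoint⇒3≤∑deficiency α⁻≗β α≗γ⁻ αx≡x
    ...   | no ¬fixed = contradiction (fixedPointFree⇒even α αα≡id (λ x αx≡x → ¬fixed (x , αx≡x))) 2∤m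
      where
      -- The three agreements chain to α = β⁻¹ = γ = α⁻¹.
      αα≡id : ∀ x → α ⟨$⟩ʳ (α ⟨$⟩ʳ x) ≡ x
      αα≡id x = trans (cong (α ⟨$⟩ʳ_) αx≡α⁻x) (inverseʳ α)
        where
        αx≡α⁻x : α ⟨$⟩ʳ x ≡ α ⟨$⟩ˡ x
        αx≡α⁻x = trans (inverse-cong (flip α) β α⁻≗β x) (trans (β⁻≗γ x) (sym (inverse-cong α (flip γ) α≗γ⁻ x)))

  -- For m = 2 the coefficient of t₀ + t₁ + t₂ + t₃ is - 1, but α x ≡ x makes s₁ and s₂ force t₁ and t₂.
  0≤∑deficiency₂ : m ≡ 2 → 0ℤ ≤ᶻ sum deficiency
  0≤∑deficiency₂ m≡2 = 0≤∑ λ x → subst (0ℤ ≤ᶻ_) (sym (trans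
      (cong (λ k → cycles x + both x + ((+ k - + 3) * (t₀ x + t₁ x + t₂ x + t₃ x)
         + (t₁ x * t₂ x * (1ℤ - t₃ x) + t₁ x * t₃ x + t₂ x * t₃ x))) m≡2)
      (identity (t₀ x) (t₁ x) (t₂ x) (t₃ x) (s₁ x) (s₂ x) (s₃ x))))
      (0≤crucial x ⊕ 0≤w₃ x ⊗ 0≤ν₃ x ⊕ 0≤t₃ x ⊗ (0≤ν₁ x ⊗ 0≤t₂ x ⊕ 0≤t₁ x))
    where
    0≤w₃ : ∀ x → 0ℤ ≤ᶻ w₃ x
    0≤w₃ x = 0≤ν (β ⟨$⟩ˡ x) (γ ⟨$⟩ʳ x)
    0≤ν₁ : ∀ x → 0ℤ ≤ᶻ 1ℤ - t₁ x
    0≤ν₁ x = 0≤ν (β ⟨$⟩ʳ x) x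
    0≤ν₃ : ∀ x → 0ℤ ≤ᶻ 1ℤ - t₃ x
    0≤ν₃ x = 0≤ν (α ⟨$⟩ʳ (γ ⟨$⟩ʳ x)) (β ⟨$⟩ˡ x)
    0≤crucial : ∀ x → 0ℤ ≤ᶻ (1ℤ - s₁ x) * (1ℤ - t₁ x) + (1ℤ - s₂ x) * (1ℤ - t₂ x) + t₁ x * t₂ x - t₀ x
    0≤crucial x with α ⟨$⟩ʳ x ≟ᶠ x
    ... | no _ = 0≤ν (α ⟨$⟩ˡ x) (β ⟨$⟩ʳ x) ⊗ 0≤ν₁ x ⊕ 0≤ν (α ⟨$⟩ʳ x) (γ ⟨$⟩ˡ x) ⊗ 0≤ν (γ ⟨$⟩ˡ x) x
               ⊕ 0≤t₁ x ⊗ 0≤t₂ x ⊕ ℤₚ.≤-refl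
    ... | yes αx≡x = subst (0ℤ ≤ᶻ_)
        (sym (trans (cong₂ (λ u v → u + v + t₁ x * t₂ x - 1ℤ)
               (absorb (α ⟨$⟩ˡ x) (β ⟨$⟩ʳ x) x (trans (cong (α ⟨$⟩ˡ_) (sym αx≡x)) (inverseˡ α)))
               (absorb (α ⟨$⟩ʳ x) (γ ⟨$⟩ˡ x) x αx≡x))
             (factor (t₁ x) (t₂ x))))
        (0≤ν₁ x ⊗ 0≤ν (γ ⟨$⟩ˡ x) x)
      where
      -- For `i ≡ k` both factors are the same indicator, and indicators are idempotent.
      absorb : ∀ i j k → i ≡ k → ν i j * ν j k ≡ ν j k
      absorb i j .i refl with i ≟ᶠ j
      ... | yes refl = trans (ℤₚ.*-zeroˡ (ν i i)) (sym (ν-≡ {i = i} refl))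
      ... | no i≢j   = ℤₚ.*-identityˡ _
      factor : ∀ t₁ t₂ → (1ℤ - t₁) + (1ℤ - t₂) + t₁ * t₂ - 1ℤ ≡ (1ℤ - t₁) * (1ℤ - t₂)
      factor = solve-∀
    identity : ∀ t₀ t₁ t₂ t₃ s₁ s₂ s₃ →
      ((1ℤ - s₁) + (1ℤ - s₂) + (1ℤ - s₃) + (t₁ * s₁ + t₂ * s₂ + t₃ * s₃)
        + ((+ 2 - + 3) * (t₀ + t₁ + t₂ + t₃) + (t₁ * t₂ * (1ℤ - t₃) + t₁ * t₃ + t₂ * t₃)))
      ≡ (1ℤ - s₁) * (1ℤ - t₁) + (1ℤ - s₂) * (1ℤ - t₂) + t₁ * t₂ - t₀
        + (1ℤ - s₃) * (1ℤ - t₃) + t₃ * ((1ℤ - t₁) * t₂ + t₁)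
    identity = solve-∀

  colorings≤quartic : 2 ≤ m → colorings ≤ᶻ quartic M
  colorings≤quartic 2≤m = subst (_≤ᶻ quartic M) (ℤₚ.+-identityʳ colorings) (colorings≤ nonneg)
    where
    nonneg : 0ℤ ≤ᶻ sum deficiency
    nonneg with ℕₚ.m≤n⇒m<n∨m≡n 2≤m
    ... | inj₁ 3≤m = 0≤∑deficiency 3≤m
    ... | inj₂ 2≡m = 0≤∑deficiency₂ (sym 2≡m)

  colorings≤quartic-3 : 2 ≤ m → ¬ 2 ∣ m → colorings ≤ᶻ quartic M - + 3
  colorings≤quartic-3 2≤m 2∤m = subst (_≤ᶻ quartic M - + 3) (cancel colorings)
    (ℤₚ.+-monoˡ-≤ (- + 3) (colorings≤ (3≤∑deficiency 3≤m 2∤m)))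
    where
    3≤m : 3 ≤ m
    3≤m = ℕₚ.≤∧≢⇒< 2≤m (λ 2≡m → 2∤m (subst (2 ∣_) 2≡m (divides 1 refl)))
    cancel : ∀ c → c + + 3 - + 3 ≡ c
    cancel = solve-∀

-- Derangements that attain the bounds

-- With β = γ = α⁻¹ and no fixed points, only the failure of α to be an involution costs colorings.
module _ {m} (α : Permutation′ m) (α≢id : ∀ x → α ⟨$⟩ʳ x ≢ x) where
  open Count α (flip α) (flip α)
  open Deficiency α (flip α) (flip α) using (deficiency; colorings+deficiency)

  derangement-deficiency : sum deficiency ≡ disagreement (α ⟨$⟩ʳ_) (α ⟨$⟩ˡ_)
  derangement-deficiency = sum-cong-≗ pointwise
    where
    α⁻≢id : ∀ x → α ⟨$⟩ˡ x ≢ x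
    α⁻≢id x α⁻x≡x = α≢id x (trans (cong (α ⟨$⟩ʳ_) (sym α⁻x≡x)) (inverseʳ α))
    pointwise : ∀ x → deficiency x ≡ ν (α ⟨$⟩ʳ x) (α ⟨$⟩ˡ x)
    -- Without fixed points all four triangle indicators are 0. The choice of `β` and `γ` makes s₁
    -- and s₂ equal to 1, so only 1 - s₃ survives.
    pointwise x = vanish {M} {s₃ = δ (α ⟨$⟩ʳ x) (α ⟨$⟩ˡ x)} (δ-≢ (α≢id x)) (δ-≢ (α⁻≢id x)) (δ-≢ (α≢id x))
      (δ-≢ (λ αα⁻x≡αx → α≢id x (trans (sym αα⁻x≡αx) (inverseʳ α)))) (δ-≡ {i = α ⟨$⟩ˡ x} refl) (δ-≡ {i = α ⟨$⟩ʳ x} refl)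
      where
      collapse : ∀ M s₃ → (1ℤ - 1ℤ) + (1ℤ - 1ℤ) + (1ℤ - s₃) + (0ℤ * 1ℤ + 0ℤ * 1ℤ + 0ℤ * s₃)
        + ((M - + 3) * (0ℤ + 0ℤ + 0ℤ + 0ℤ) + (0ℤ * 0ℤ * (1ℤ - 0ℤ) + 0ℤ * 0ℤ + 0ℤ * 0ℤ)) ≡ 1ℤ - s₃
      collapse = solve-∀
      vanish : ∀ {M t₀ t₁ t₂ t₃ s₁ s₂ s₃} →
        t₀ ≡ 0ℤ → t₁ ≡ 0ℤ → t₂ ≡ 0ℤ → t₃ ≡ 0ℤ → s₁ ≡ 1ℤ → s₂ ≡ 1ℤ →
        (1ℤ - s₁) + (1ℤ - s₂) + (1ℤ - s₃) + (t₁ * s₁ + t₂ * s₂ + t₃ * s₃)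
        + ((M - + 3) * (t₀ + t₁ + t₂ + t₃) + (t₁ * t₂ * (1ℤ - t₃) + t₁ * t₃ + t₂ * t₃)) ≡ 1ℤ - s₃
      vanish {M} {s₃ = s₃} refl refl refl refl refl refl = collapse M s₃

  derangement-colorings : colorings + disagreement (α ⟨$⟩ʳ_) (α ⟨$⟩ˡ_) ≡ quartic (+ m)
  derangement-colorings = trans (cong (_+_ colorings) (sym derangement-deficiency)) colorings+deficiency

swapPair : Permutation′ m → Permutation′ (2 ℕ.+ m)
swapPair {m} π = permutation to from
  (λ { 0F → refl ; 1F → refl ; (suc (suc i)) → cong (λ j → suc (suc j)) (inverseʳ π) })
  (λ { 0F → refl ; 1F → refl ; (suc (suc i)) → cong (λ j → suc (suc j)) (inverseˡ π) })
  where
  to from : Fin (2 ℕ.+ m) → Fin (2 ℕ.+ m)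
  to 0F            = 1F
  to 1F            = 0F
  to (suc (suc i)) = suc (suc (π ⟨$⟩ʳ i))
  from 0F            = 1F
  from 1F            = 0F
  from (suc (suc i)) = suc (suc (π ⟨$⟩ˡ i))

threeCycle : Permutation′ 3
threeCycle = permutation
  (λ { 0F → 1F ; 1F → 2F ; 2F → 0F }) (λ { 0F → 2F ; 1F → 0F ; 2F → 1F })
  (λ { 0F → refl ; 1F → refl ; 2F → refl }) (λ { 0F → refl ; 1F → refl ; 2F → refl })

Derangement : ℕ → Set
Derangement m = ∃ λ (π : Permutation′ m) → (∀ x → π ⟨$⟩ʳ x ≢ x) ×
  disagreement (π ⟨$⟩ʳ_) (π ⟨$⟩ˡ_) ≡ + defect m

swapPair-derangement : Derangement m → Derangement (2 ℕ.+ m)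
swapPair-derangement (π , π≢id , disagree) = swapPair π
  , (λ { 0F () ; 1F () ; (suc (suc i)) eq → π≢id i (suc-injective (suc-injective eq)) })
  , trans (ℤₚ.+-identityˡ _) (trans (ℤₚ.+-identityˡ _) disagree)

-- A transposition is its own inverse, so adjoining one adds no disagreement. The descent must end
-- at 0 or 3, because a single point has no derangement; the nested pattern of the last clause keeps
-- the remaining `m` away from 1.
derangement : ∀ m → m ≢ 1 → Derangement m
derangement 0 _   = id , (λ ()) , refl
derangement 1 1≢1 = contradiction refl 1≢1
derangement 2 _   = swapPair-derangement (derangement 0 λ ())
derangement 3 _   = threeCycle , (λ { 0F () ; 1F () ; 2F () }) , refl
derangement (suc (suc m@(suc (suc _)))) _ = swapPair-derangement (derangement m λ ())

-- The formula as a quartic minus the defect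

even⇒defect≡0 : ∀ m → 2 ∣ m → defect m ≡ 0
even⇒defect≡0 0 _ = refl
even⇒defect≡0 1 (divides 0 ())
even⇒defect≡0 1 (divides (suc _) ())
even⇒defect≡0 (suc (suc m)) 2∣m = even⇒defect≡0 m (∣m+n∣m⇒∣n 2∣m ∣-refl)

odd⇒defect≡3 : ∀ m → ¬ 2 ∣ m → defect m ≡ 3
odd⇒defect≡3 0 2∤0 = contradiction (divides 0 refl) 2∤0
odd⇒defect≡3 1 _   = refl
odd⇒defect≡3 (suc (suc m)) 2∤m = odd⇒defect≡3 m (2∤m ∘ ∣m∣n⇒∣m+n ∣-refl)

formula≡ : ∀ m → formula m ≡ quartic (+ m) - + defect m
formula≡ m = split (2 ∣? m)
  where
  expand : ∀ x → x * (x * (x * (x * 1ℤ))) - + 6 * (x * (x * (x * 1ℤ))) + + 15 * (x * (x * 1ℤ)) - + 13 * x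
    ≡ x * (x * (x * (x - + 6) + + 15) - + 13)
  expand = solve-∀
  q : ℤ
  q = (+ m) ^ 4 - + 6 * (+ m) ^ 3 + + 15 * (+ m) ^ 2 - + 13 * (+ m)
  split : (even? : Dec (2 ∣ m)) → (if does even? then q else q - + 3) ≡ quartic (+ m) - + defect m
  split (yes 2∣m) = trans (sym (ℤₚ.+-identityʳ q))
    (cong₂ (λ x d → x - + d) (expand (+ m)) (sym (even⇒defect≡0 m 2∣m)))
  split (no 2∤m) = cong₂ (λ x d → x - + d) (expand (+ m)) (sym (odd⇒defect≡3 m 2∤m))

-- The formula is moved from ℤ to ℕ because the difference argument maps the value into the ring by
-- `natEmbed`, which accepts natural numbers only.
formula-ℕ : ∀ m k → + k ≡ formula m → k ℕ.+ defect m ℕ.+ negativePart m ≡ positivePart m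
formula-ℕ m k +k≡ = ℤₚ.+-injective (begin
  + k + + defect m + + negativePart m                          ≡⟨ cong₂ (λ x y → x + + defect m + y) (trans +k≡ (formula≡ m)) +negative ⟩
  quartic M - + defect m + + defect m + M * (+ 13 + M * (M * + 6))   ≡⟨ balance M (+ defect m) ⟩
  M * (M * (+ 15 + M * (M * + 1)))                  ≡⟨ +positive ⟨
  + positivePart m                                             ∎)
  where
  open ≡-Reasoning
  M = + m
  balance : ∀ M d → M * (M * (M * (M - + 6) + + 15) - + 13) - d + d + M * (+ 13 + M * (M * + 6)) ≡ M * (M * (+ 15 + M * (M * + 1)))
  balance = solve-∀
  +negative : + negativePart m ≡ M * (+ 13 + M * (M * + 6))
  +negative = trans (ℤₚ.pos-* m _) (cong (λ x → M * (+ 13 + x)) (trans (ℤₚ.pos-* m _) (cong (M *_) (ℤₚ.pos-* m 6))))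
  +positive : + positivePart m ≡ M * (M * (+ 15 + M * (M * + 1)))
  +positive = trans (ℤₚ.pos-* m _) (cong (M *_) (trans (ℤₚ.pos-* m _) (cong (λ x → M * (+ 15 + x)) (trans (ℤₚ.pos-* m _) (cong (M *_) (ℤₚ.pos-* m 1))))))

-- Comparing finite lists and subsets

unique⇒lookup-injective : ∀ {A : Set} {xs : List A} → Unique xs → ∀ i j → lookup xs i ≡ lookup xs j → i ≡ j
unique⇒lookup-injective (_ ∷ _)   zero    zero    _  = refl
unique⇒lookup-injective {xs = _ ∷ xs} (x∉ ∷ _) zero (suc j) eq = contradiction eq (All.lookup x∉ (∈-lookup {xs = xs} j))
unique⇒lookup-injective {xs = _ ∷ xs} (x∉ ∷ _) (suc i) zero eq = contradiction (sym eq) (All.lookup x∉ (∈-lookup {xs = xs} i))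
unique⇒lookup-injective (_ ∷ u)   (suc i) (suc j) eq = cong suc (unique⇒lookup-injective u i j eq)

-- Applied to a relation and to its converse, this gives equal lengths without a pair of inverse
-- functions between the lists.
length-≤-by-relation : ∀ {A B : Set} (R : A → B → Set) {xs : List A} {ys : List B} → Unique xs →
  (∀ {x} → x ∈ xs → ∃ λ y → y ∈ ys × R x y) → (∀ {x x′ y} → R x y → R x′ y → x ≡ x′) →
  length xs ≤ length ys
length-≤-by-relation R {xs} {ys} unique total leftUnique = injective⇒≤ {f = f} f-injective
  where
  f : Fin (length xs) → Fin (length ys)
  f i = index (proj₁ (proj₂ (total (∈-lookup {xs = xs} i))))
  R-f : ∀ i → R (lookup xs i) (lookup ys (f i))
  R-f i = let y , y∈ys , Rxy = total (∈-lookup {xs = xs} i) in subst (R _) (lookup-index y∈ys) Rxy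
  f-injective : Injective _≡_ _≡_ f
  f-injective {i} {j} fi≡fj = unique⇒lookup-injective unique i j
    (leftUnique (R-f i) (subst (R _ ∘ lookup ys) (sym fi≡fj) (R-f j)))

-- Punching out a missed value would inject the domain into a smaller set.
injective⇒surjective : ∀ {m n} {f : Fin m → Fin n} → m ≡ n → Injective _≡_ _≡_ f → ∀ y → ∃ λ x → f x ≡ y
injective⇒surjective {suc _} {f = f} refl f-injective y with any? (λ x → f x ≟ᶠ y)
... | yes hit = hit
... | no miss = contradiction
  (injective⇒≤ (f-injective ∘ punchOut-injective (λ y≡fx → miss (_ , sym y≡fx)) (λ y≡fx → miss (_ , sym y≡fx))))
  ℕₚ.1+n≰n

enumerate : ∀ {n} (S : Subset n) → Fin ∣ S ∣ → Fin n
enumerate (inside  ∷ S) zero    = zero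
enumerate (inside  ∷ S) (suc i) = suc (enumerate S i)
enumerate (outside ∷ S) i       = suc (enumerate S i)

enumerate-∈ : ∀ {n} (S : Subset n) i → enumerate S i ∈ˢ S
enumerate-∈ (inside  ∷ S) zero    = here
enumerate-∈ (inside  ∷ S) (suc i) = there (enumerate-∈ S i)
enumerate-∈ (outside ∷ S) i       = there (enumerate-∈ S i)

enumerate-injective : ∀ {n} (S : Subset n) {i j} → enumerate S i ≡ enumerate S j → i ≡ j
enumerate-injective (inside  ∷ S) {zero}  {zero}  _  = refl
enumerate-injective (inside  ∷ S) {suc i} {suc j} eq = cong suc (enumerate-injective S (suc-injective eq))
enumerate-injective (outside ∷ S) eq = enumerate-injective S (suc-injective eq)

enumerate-surjective : ∀ {n} (S : Subset n) {x} → x ∈ˢ S → ∃ λ i → enumerate S i ≡ x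
enumerate-surjective (inside  ∷ S) here = zero , refl
enumerate-surjective (inside  ∷ S) (there x∈S) with i , refl ← enumerate-surjective S x∈S = suc i , refl
enumerate-surjective (outside ∷ S) (there x∈S) with i , refl ← enumerate-surjective S x∈S = i , refl

∣S∣≡1⇒unique : ∀ {n} (S : Subset n) → ∣ S ∣ ≡ 1 → ∃ λ x → x ∈ˢ S × (∀ {y} → y ∈ˢ S → y ≡ x)
∣S∣≡1⇒unique S ∣S∣≡1 = enumerate S (first ∣S∣≡1) , enumerate-∈ S _ ,
  λ y∈S → let j , eq = enumerate-surjective S y∈S in trans (sym eq) (cong (enumerate S) (only ∣S∣≡1 j _))
  where
  first : ∀ {k} → k ≡ 1 → Fin k
  first refl = zero
  only : ∀ {k} → k ≡ 1 → (i j : Fin k) → i ≡ j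
  only refl zero zero = refl

unique⇒∣S∣≡1 : ∀ {n} {S : Subset n} {x} → x ∈ˢ S → (∀ {y} → y ∈ˢ S → y ≡ x) → ∣ S ∣ ≡ 1
unique⇒∣S∣≡1 {S = S} {x} x∈S only = trans (cong ∣_∣ (⊆-antisym S⊆⁅x⁆ ⁅x⁆⊆S)) (∣⁅x⁆∣≡1 x)
  where
  S⊆⁅x⁆ : ∀ {y} → y ∈ˢ S → y ∈ˢ ⁅ x ⁆
  S⊆⁅x⁆ y∈S = subst (_∈ˢ ⁅ x ⁆) (sym (only y∈S)) (x∈⁅x⁆ x)
  ⁅x⁆⊆S : ∀ {y} → y ∈ˢ ⁅ x ⁆ → y ∈ˢ S
  ⁅x⁆⊆S y∈ = subst (_∈ˢ S) (sym (x∈⁅y⁆⇒x≡y x y∈)) x∈S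

∈-allSubsets : ∀ {n} (S : Subset n) → S ∈ allSubsets n
∈-allSubsets []            = here refl
∈-allSubsets (inside  ∷ S) = ∈-++⁺ˡ (∈-map⁺ (inside ∷_) (∈-allSubsets S))
∈-allSubsets (outside ∷ S) = ∈-++⁺ʳ _ (∈-map⁺ (outside ∷_) (∈-allSubsets S))

allSubsets-unique : ∀ n → Unique (allSubsets n)
allSubsets-unique zero    = All.[] ∷ []
allSubsets-unique (suc n) = Unique.++⁺
  (Unique.map⁺ (λ { refl → refl }) (allSubsets-unique n))
  (Unique.map⁺ (λ { refl → refl }) (allSubsets-unique n))
  λ (S∈ , S∈′) → case ∈-map⁻ _ S∈ , ∈-map⁻ _ S∈′ of λ { ((_ , _ , refl) , (_ , _ , ())) }

-- Edges between two parts, and partners in a full cover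

module EdgesBetween (H : Graph) where
  open Graph H

  edgesBetween-unique : ∀ A B → Unique (edgesBetween A B)
  edgesBetween-unique A B = Unique.filter⁺ _ (Unique.filter⁺ _ (Unique.cartesianProduct⁺ (Unique.allFin⁺ order) (Unique.allFin⁺ order)))

  ∈-edges⁺ : ∀ {x y} → x <ᶠ y → Adj x y → (x , y) ∈ edges
  ∈-edges⁺ x<y x~y = ∈-filter⁺ _ (∈-cartesianProduct⁺ (∈-allFin _) (∈-allFin _)) (x<y , x~y)

  ∈-edges⁻ : ∀ {x y} → (x , y) ∈ edges → x <ᶠ y × Adj x y
  ∈-edges⁻ xy∈ = proj₂ (∈-filter⁻ _ {xs = cartesianProduct (allFin order) (allFin order)} xy∈)

  adj⇒edge : ∀ A B {x y} → Adj x y → x ∈ˢ A → y ∈ˢ B →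
    ∃ λ e → e ∈ edgesBetween A B × (e ≡ (x , y) ⊎ e ≡ (y , x))
  adj⇒edge A B {x} {y} x~y x∈A y∈B with <-cmp x y
  ... | tri< x<y _ _  = (x , y) , ∈-filter⁺ (joins? A B) (∈-edges⁺ x<y x~y) (inj₁ (x∈A , y∈B)) , inj₁ refl
  ... | tri≈ _ x≡y _  = contradiction x~y (irrefl x≡y)
  ... | tri> _ _ y<x  = (y , x) , ∈-filter⁺ (joins? A B) (∈-edges⁺ y<x (symm x~y)) (inj₂ (y∈B , x∈A)) , inj₂ refl

  edge⇒adj : ∀ A B {e} → e ∈ edgesBetween A B →
    ∃ λ x → ∃ λ y → Adj x y × x ∈ˢ A × y ∈ˢ B × (e ≡ (x , y) ⊎ e ≡ (y , x))
  edge⇒adj A B {x , y} e∈ with e∈edges , joins ← ∈-filter⁻ (joins? A B) {xs = edges} e∈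
    with _ , x~y ← ∈-edges⁻ e∈edges | joins
  ... | inj₁ (x∈A , y∈B) = x , y , x~y , x∈A , y∈B , inj₁ refl
  ... | inj₂ (x∈B , y∈A) = y , x , symm x~y , y∈A , x∈B , inj₂ refl

  edge-ordered : ∀ A B {x y} → (x , y) ∈ edgesBetween A B → x <ᶠ y
  edge-ordered A B xy∈ = proj₁ (∈-edges⁻ (proj₁ (∈-filter⁻ (joins? A B) {xs = edges} xy∈)))

  -- Edges are listed with the smaller vertex first, so e and f cannot be reversals of each other.
  same-ends⇒≡ : ∀ A B {e f x y} → e ∈ edgesBetween A B → f ∈ edgesBetween A B →
    e ≡ (x , y) ⊎ e ≡ (y , x) → f ≡ (x , y) ⊎ f ≡ (y , x) → e ≡ f
  same-ends⇒≡ A B e∈ f∈ (inj₁ refl) (inj₁ refl) = refl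
  same-ends⇒≡ A B e∈ f∈ (inj₂ refl) (inj₂ refl) = refl
  same-ends⇒≡ A B e∈ f∈ (inj₁ refl) (inj₂ refl) = contradiction (edge-ordered A B f∈) (<-asym (edge-ordered A B e∈))
  same-ends⇒≡ A B e∈ f∈ (inj₂ refl) (inj₁ refl) = contradiction (edge-ordered A B f∈) (<-asym (edge-ordered A B e∈))

module Partners {G : Graph} (𝓗 : Cover G) {m} (full : Cover.IsFullFold 𝓗 m) where
  open Cover 𝓗
  private
    module G = Graph G
    module H = Graph H
  open EdgesBetween H

  abstract
    -- The matching condition identifies the two edges at x. As the listing fixes their direction, x
    -- may be the first or the second entry of either, and the other ends agree in every case.
    partner-unique : ∀ {u v x y y′} → G.Adj u v → x ∈ˢ L u → y ∈ˢ L v → y′ ∈ˢ L v →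
      H.Adj x y → H.Adj x y′ → y ≡ y′
    partner-unique {u} {v} {x} {y} {y′} u~v x∈ y∈ y′∈ x~y x~y′
      with e , e∈ , e≡ ← adj⇒edge (L u) (L v) x~y x∈ y∈ | f , f∈ , f≡ ← adj⇒edge (L u) (L v) x~y′ x∈ y′∈
      = other e≡ f≡ (matching u~v e∈ f∈ x (endpoint e≡) (endpoint f≡))
      where
      endpoint : ∀ {e z} → e ≡ (x , z) ⊎ e ≡ (z , x) → H.Endpoint x e
      endpoint (inj₁ refl) = inj₁ refl
      endpoint (inj₂ refl) = inj₂ refl
      other : ∀ {e f} → e ≡ (x , y) ⊎ e ≡ (y , x) → f ≡ (x , y′) ⊎ f ≡ (y′ , x) → e ≡ f → y ≡ y′
      other (inj₁ refl) (inj₁ refl) refl = refl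
      other (inj₁ refl) (inj₂ refl) refl = refl
      other (inj₂ refl) (inj₁ refl) refl = refl
      other (inj₂ refl) (inj₂ refl) refl = refl

    -- The edges between L u and L v have distinct endpoints in L u, and there are as many of them as vertices of L u.
    partner : ∀ {u v x} → G.Adj u v → x ∈ˢ L u → ∃ λ y → y ∈ˢ L v × H.Adj x y
    partner {u} {v} {x} u~v x∈ =
      let k , k≡x = enumerate-surjective (L u) x∈
          i , i≡k = injective⇒surjective (trans (proj₂ full u~v) (sym (proj₁ full u))) end-injective k
          s = start i
          y , s~y , _ , y∈ , _ = proj₂ (edge i)
      in y , y∈ , subst (λ z → H.Adj z y) (trans (sym (end-start i)) (trans (cong (enumerate (L u)) i≡k) k≡x)) s~y
      where
      E : List (H.V × H.V)
      E = H.edgesBetween (L u) (L v)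
      edge : ∀ i → ∃ λ x → ∃ λ y → H.Adj x y × x ∈ˢ L u × y ∈ˢ L v × (lookup E i ≡ (x , y) ⊎ lookup E i ≡ (y , x))
      edge i = edge⇒adj (L u) (L v) (∈-lookup {xs = E} i)
      start : Fin (length E) → H.V
      start i = proj₁ (edge i)
      start-∈ : ∀ i → start i ∈ˢ L u
      start-∈ i = let _ , _ , _ , s∈ , _ = edge i in s∈
      start-endpoint : ∀ i → H.Endpoint (start i) (lookup E i)
      start-endpoint i with edge i
      ... | _ , _ , _ , _ , _ , inj₁ e≡ = inj₁ (sym (cong proj₁ e≡))
      ... | _ , _ , _ , _ , _ , inj₂ e≡ = inj₂ (sym (cong proj₂ e≡))
      end : Fin (length E) → Fin ∣ L u ∣
      end i = proj₁ (enumerate-surjective (L u) (start-∈ i))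
      end-start : ∀ i → enumerate (L u) (end i) ≡ start i
      end-start i = proj₂ (enumerate-surjective (L u) (start-∈ i))
      end-injective : Injective _≡_ _≡_ end
      end-injective {i} {j} eq = unique⇒lookup-injective (edgesBetween-unique (L u) (L v)) i j
        (matching u~v (∈-lookup {xs = E} i) (∈-lookup {xs = E} j) (start i) (start-endpoint i)
          (subst (λ z → H.Endpoint z (lookup E j))
            (sym (trans (sym (end-start i)) (trans (cong (enumerate (L u)) eq) (end-start j)))) (start-endpoint j)))

-- Normal form of a full cover

-- Common interface of arbitrary full covers and of the constructed ones, so that the colorings are
-- counted once for both. The triangle is oriented 1 → 2 → 3 → 1, hence the inverse of `γ` wherever
-- a constraint is read from part 1 to part 3.
record Coordinates (𝓗 : Cover K₄) (m : ℕ) : Set where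
  open Cover 𝓗
  private module H = Graph H
  field
    e            : Fin 4 → Fin m → H.V
    e-∈          : ∀ v i → e v i ∈ˢ L v
    e-injective  : ∀ v {i j} → e v i ≡ e v j → i ≡ j
    e-surjective : ∀ v {x} → x ∈ˢ L v → ∃ λ i → e v i ≡ x

  MatchedBy : Fin 4 → Fin 4 → (Fin m → Fin m) → Set
  MatchedBy u v π = ∀ {i j} → H.Adj (e u i) (e v j) ⇔ π i ≡ j

  field
    α β γ : Permutation′ m
    e₀~   : ∀ {v} → 0F ≢ v → MatchedBy 0F v (λ i → i)
    e₁~e₂ : MatchedBy 1F 2F (α ⟨$⟩ʳ_)
    e₂~e₃ : MatchedBy 2F 3F (β ⟨$⟩ʳ_)
    e₃~e₁ : MatchedBy 3F 1F (γ ⟨$⟩ʳ_)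

-- Transporting an enumeration of L 0 along the matchings with L 1, L 2 and L 3 makes these matchings trivial.
coordinates : ∀ (𝓗 : Cover K₄) {m} → Cover.IsFullFold 𝓗 m → Coordinates 𝓗 m
coordinates 𝓗 {m} full = record
  { e = e ; e-∈ = e-∈ ; e-injective = λ v → e-injective v ; e-surjective = λ v → e-surjective v
  ; α = σ 1F 2F 1≢2 ; β = σ 2F 3F 2≢3 ; γ = σ 3F 1F 3≢1
  ; e₀~ = λ {v} → e₀~ v
  ; e₁~e₂ = σ-matched 1F 2F 1≢2 ; e₂~e₃ = σ-matched 2F 3F 2≢3 ; e₃~e₁ = σ-matched 3F 1F 3≢1 }
  where
  open Cover 𝓗
  module H = Graph H
  open Partners 𝓗 full

  enumerated : ∀ {k} → ∣ L 0F ∣ ≡ k → ∃ λ (f : Fin k → H.V) → (∀ i → f i ∈ˢ L 0F) ×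
    (∀ {i j} → f i ≡ f j → i ≡ j) × (∀ {x} → x ∈ˢ L 0F → ∃ λ i → f i ≡ x)
  enumerated refl = enumerate (L 0F) , enumerate-∈ (L 0F) , enumerate-injective (L 0F) , enumerate-surjective (L 0F)

  e₀ = proj₁ (enumerated (proj₁ full 0F))
  e₀-∈ = proj₁ (proj₂ (enumerated (proj₁ full 0F)))

  module _ {v : Fin 4} (0≢v : 0F ≢ v) where
    transport = λ i → partner {v = v} 0≢v (e₀-∈ i)
    transport-∈ = λ i → proj₁ (proj₂ (transport i))
    transport-~ = λ i → proj₂ (proj₂ (transport i))

    transport-injective : ∀ {i j} → proj₁ (transport i) ≡ proj₁ (transport j) → i ≡ j
    transport-injective {i} {j} eq = proj₁ (proj₂ (proj₂ (enumerated (proj₁ full 0F))))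
      (partner-unique (0≢v ∘ sym) (transport-∈ i) (e₀-∈ i) (e₀-∈ j) (H.symm (transport-~ i))
        (subst (λ z → H.Adj z (e₀ j)) (sym eq) (H.symm (transport-~ j))))

    transport-surjective : ∀ {x} → x ∈ˢ L v → ∃ λ i → proj₁ (transport i) ≡ x
    transport-surjective {x} x∈ =
      -- The index is that of the partner of x in `L 0F`, whose own partner in `L v` can only be x.
      let y , y∈ , x~y = partner (0≢v ∘ sym) x∈
          i , i≡y = proj₂ (proj₂ (proj₂ (enumerated (proj₁ full 0F)))) y∈
      in i , partner-unique 0≢v (e₀-∈ i) (transport-∈ i) x∈ (transport-~ i)
               (subst (λ z → H.Adj z x) (sym i≡y) (H.symm x~y))

  1≢2 : (Fin 4 ∋ 1F) ≢ 2F
  1≢2 ()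

  2≢3 : (Fin 4 ∋ 2F) ≢ 3F
  2≢3 ()

  3≢1 : (Fin 4 ∋ 3F) ≢ 1F
  3≢1 ()

  0≢suc : ∀ {i : Fin 3} → 0F ≢ suc i
  0≢suc ()

  e : Fin 4 → Fin m → H.V
  e 0F      i = e₀ i
  e (suc _) i = proj₁ (transport 0≢suc i)

  e-∈ : ∀ v i → e v i ∈ˢ L v
  e-∈ 0F      i = e₀-∈ i
  e-∈ (suc _) i = transport-∈ 0≢suc i

  e-injective : ∀ v {i j} → e v i ≡ e v j → i ≡ j
  e-injective 0F      = proj₁ (proj₂ (proj₂ (enumerated (proj₁ full 0F))))
  e-injective (suc _) = transport-injective 0≢suc

  e-surjective : ∀ v {x} → x ∈ˢ L v → ∃ λ i → e v i ≡ x
  e-surjective 0F      = proj₂ (proj₂ (proj₂ (enumerated (proj₁ full 0F))))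
  e-surjective (suc _) = transport-surjective 0≢suc

  matched : ∀ {u v} → u ≢ v → ∀ {i k j} → H.Adj (e u i) (e v k) → H.Adj (e u i) (e v j) ⇔ k ≡ j
  matched {u} {v} u≢v {i} {k} {j} i~k = mk⇔
    (λ i~j → e-injective v (partner-unique u≢v (e-∈ u i) (e-∈ v k) (e-∈ v j) i~k i~j))
    (λ { refl → i~k })

  e₀~ : ∀ v → 0F ≢ v → ∀ {i j} → H.Adj (e 0F i) (e v j) ⇔ i ≡ j
  e₀~ 0F      0≢0 with () ← 0≢0 refl
  e₀~ (suc v) 0≢v {i} = matched 0≢v (transport-~ 0≢suc i)

  step : ∀ u v → u ≢ v → ∀ i → ∃ λ j → H.Adj (e u i) (e v j)
  step u v u≢v i =
    let y , y∈ , i~y = partner u≢v (e-∈ u i)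
        j , j≡y = e-surjective v y∈
    in j , subst (H.Adj (e u i)) (sym j≡y) i~y

  step-inverse : ∀ u v (u≢v : u ≢ v) (v≢u : v ≢ u) j → proj₁ (step u v u≢v (proj₁ (step v u v≢u j))) ≡ j
  step-inverse u v u≢v v≢u j = Equivalence.to (matched u≢v (proj₂ (step u v u≢v _))) (H.symm (proj₂ (step v u v≢u j)))

  σ : ∀ u v → u ≢ v → Permutation′ m
  σ u v u≢v = permutation (proj₁ ∘ step u v u≢v) (proj₁ ∘ step v u (u≢v ∘ sym))
    (step-inverse u v u≢v (u≢v ∘ sym)) (step-inverse v u (u≢v ∘ sym) u≢v)

  σ-matched : ∀ u v (u≢v : u ≢ v) {i j} → H.Adj (e u i) (e v j) ⇔ σ u v u≢v ⟨$⟩ʳ i ≡ j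
  σ-matched u v u≢v {i} = matched u≢v (proj₂ (step u v u≢v i))

-- Proper colorings as quadruples of colors

filter-map-length : ∀ {A B : Set} {P : B → Set} (P? : Decidable P) (f : A → B) xs →
  length (filter P? (map f xs)) ≡ length (filter (P? ∘ f) xs)
filter-map-length P? f []       = refl
filter-map-length P? f (x ∷ xs) with does (P? (f x))
... | true  = cong suc (filter-map-length P? f xs)
... | false = filter-map-length P? f xs

length-filter-allFin : ∀ {m} {P : Fin m → Set} (P? : Decidable P) →
  + length (filter P? (allFin m)) ≡ ∑[ i < m ] ι (P? i)
length-filter-allFin {m} {P} P? = go m (λ i → i)
  where
  go : ∀ n (g : Fin n → Fin m) → + length (filter P? (tabulate g)) ≡ ∑[ i < n ] ι (P? (g i))
  go zero    g = refl
  go (suc n) g with does (P? (g zero))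
  ... | true  = cong (_+_ 1ℤ) (go n (g ∘ suc))
  ... | false = trans (go n (g ∘ suc)) (sym (ℤₚ.+-identityˡ _))

length-filter-cartesianProduct : ∀ {m} {B : Set} {P : Fin m × B → Set} (P? : Decidable P) (ys : List B) →
  + length (filter P? (cartesianProduct (allFin m) ys)) ≡ ∑[ i < m ] (+ length (filter (λ y → P? (i , y)) ys))
length-filter-cartesianProduct {m} P? ys = go m (λ i → i)
  where
  go : ∀ n (g : Fin n → Fin m) → + length (filter P? (cartesianProduct (tabulate g) ys)) ≡
    ∑[ i < n ] (+ length (filter (λ y → P? (g i , y)) ys))
  go zero    g = refl
  go (suc n) g = trans
    (cong +_ (trans (cong length (filter-++ P? (map (g zero ,_) ys) _))
      (trans (length-++ (filter P? (map (g zero ,_) ys)))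
        (cong (ℕ._+ length (filter P? (cartesianProduct (tabulate (g ∘ suc)) ys))) (filter-map-length P? (g zero ,_) ys)))))
    (cong (_+_ (+ length (filter (λ y → P? (g zero , y)) ys))) (go n (g ∘ suc)))

ι-× : ∀ {A B : Set} (a? : Dec A) (b? : Dec B) → ι (a? ×-dec b?) ≡ ι a? * ι b?
ι-× (no  _) b?      = refl
ι-× (yes _) (yes _) = refl
ι-× (yes _) (no  _) = refl

ι-¬ : ∀ {A : Set} (a? : Dec A) → ι (¬? a?) ≡ 1ℤ - ι a?
ι-¬ (yes _) = refl
ι-¬ (no  _) = refl

comprehension : ∀ {n} {P : Fin n → Set} → Decidable P → Subset n
comprehension P? = Vec.tabulate (does ∘ P?)

∈-comprehension⁺ : ∀ {n} {P : Fin n → Set} (P? : Decidable P) {x} → P x → x ∈ˢ comprehension P?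
∈-comprehension⁺ P? {x} Px = lookup⇒[]= x _ (trans (lookup∘tabulate (does ∘ P?) x) (dec-true (P? x) Px))

∈-comprehension⁻ : ∀ {n} {P : Fin n → Set} (P? : Decidable P) {x} → x ∈ˢ comprehension P? → P x
∈-comprehension⁻ P? {x} x∈ with P? x | trans (sym (lookup∘tabulate (does ∘ P?) x)) ([]=⇒lookup x∈)
... | yes Px | _ = Px
... | no _   | ()

module _ {m} (α β γ : Permutation′ m) where
  Quadruple : Set
  Quadruple = Fin m × Fin m × Fin m × Fin m

  -- Bracketed so that the indicator factors into `F a b c` and the factor that depends on `d`, as
  -- in `Count.colorings`.
  Proper : Quadruple → Set
  Proper (a , b , c , d) =
    (a ≢ b × a ≢ c × α ⟨$⟩ʳ b ≢ c) × (a ≢ d × β ⟨$⟩ʳ c ≢ d × γ ⟨$⟩ˡ b ≢ d)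

  proper? : Decidable Proper
  proper? (a , b , c , d) =
    (¬? (a ≟ᶠ b) ×-dec (¬? (a ≟ᶠ c) ×-dec ¬? (α ⟨$⟩ʳ b ≟ᶠ c)))
    ×-dec (¬? (a ≟ᶠ d) ×-dec (¬? (β ⟨$⟩ʳ c ≟ᶠ d) ×-dec ¬? (γ ⟨$⟩ˡ b ≟ᶠ d)))

  properQuadruples : List Quadruple
  properQuadruples = filter proper?
    (cartesianProduct (allFin m) (cartesianProduct (allFin m) (cartesianProduct (allFin m) (allFin m))))

  properQuadruples-unique : Unique properQuadruples
  properQuadruples-unique = Unique.filter⁺ proper?
    (Unique.cartesianProduct⁺ (Unique.allFin⁺ m) (Unique.cartesianProduct⁺ (Unique.allFin⁺ m)
      (Unique.cartesianProduct⁺ (Unique.allFin⁺ m) (Unique.allFin⁺ m))))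

  ∈-properQuadruples : ∀ {q} → Proper q → q ∈ properQuadruples
  ∈-properQuadruples = ∈-filter⁺ proper?
    (∈-cartesianProduct⁺ (∈-allFin _) (∈-cartesianProduct⁺ (∈-allFin _) (∈-cartesianProduct⁺ (∈-allFin _) (∈-allFin _))))

  length-properQuadruples : + length properQuadruples ≡ Count.colorings α β γ
  length-properQuadruples =
    trans (length-filter-cartesianProduct proper? _) (sum-cong-≗ λ a →
    trans (length-filter-cartesianProduct (λ q → proper? (a , q)) _) (sum-cong-≗ λ b →
    trans (length-filter-cartesianProduct (λ q → proper? (a , b , q)) _) (sum-cong-≗ λ c →
    trans (length-filter-allFin (λ d → proper? (a , b , c , d)))
      (trans (sum-cong-≗ (λ d → trans (ι-× (triangle? a b c) (¬? (a ≟ᶠ d) ×-dec (¬? (β ⟨$⟩ʳ c ≟ᶠ d) ×-dec ¬? (γ ⟨$⟩ˡ b ≟ᶠ d))))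
               (cong₂ _*_ (ι-¬³ (a ≟ᶠ b) (a ≟ᶠ c) (α ⟨$⟩ʳ b ≟ᶠ c)) (ι-¬³ (a ≟ᶠ d) (β ⟨$⟩ʳ c ≟ᶠ d) (γ ⟨$⟩ˡ b ≟ᶠ d)))))
        (sym (*-distribˡ-sum (Count.F α β γ a b c) (λ d → ν a d * (ν (β ⟨$⟩ʳ c) d * ν (γ ⟨$⟩ˡ b) d))))))))
    where
    triangle? : ∀ a b c → Dec (a ≢ b × a ≢ c × α ⟨$⟩ʳ b ≢ c)
    triangle? a b c = ¬? (a ≟ᶠ b) ×-dec (¬? (a ≟ᶠ c) ×-dec ¬? (α ⟨$⟩ʳ b ≟ᶠ c))
    ι-¬³ : ∀ {A B C : Set} (a? : Dec A) (b? : Dec B) (c? : Dec C) →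
      ι (¬? a? ×-dec (¬? b? ×-dec ¬? c?)) ≡ (1ℤ - ι a?) * ((1ℤ - ι b?) * (1ℤ - ι c?))
    ι-¬³ a? b? c? = trans (ι-× (¬? a?) (¬? b? ×-dec ¬? c?))
      (cong₂ _*_ (ι-¬ a?) (trans (ι-× (¬? b?) (¬? c?)) (cong₂ _*_ (ι-¬ b?) (ι-¬ c?))))

module ProperColorings {𝓗 : Cover K₄} {m} (coords : Coordinates 𝓗 m) where
  open Cover 𝓗
  open Coordinates coords
  private module H = Graph H

  coordinate : Quadruple α β γ → Fin 4 → Fin m
  coordinate (a , b , c , d) 0F = a
  coordinate (a , b , c , d) 1F = b
  coordinate (a , b , c , d) 2F = c
  coordinate (a , b , c , d) 3F = d

  coordinate-injective : ∀ q q′ → (∀ v → coordinate q v ≡ coordinate q′ v) → q ≡ q′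
  coordinate-injective q q′ eq = cong₂ _,_ (eq 0F) (cong₂ _,_ (eq 1F) (cong₂ _,_ (eq 2F) (eq 3F)))

  vertex : Quadruple α β γ → Fin 4 → H.V
  vertex q v = e v (coordinate q v)

  Nonadjacent : Quadruple α β γ → Set
  Nonadjacent q = ∀ u v → ¬ H.Adj (vertex q u) (vertex q v)

  proper⇒nonadjacent : ∀ q → Proper α β γ q → Nonadjacent q
  proper⇒nonadjacent q@(a , b , c , d) ((a≢b , a≢c , αb≢c) , (a≢d , βc≢d , γ⁻b≢d)) = nonadj
    where
    n₀₁ : ¬ H.Adj (vertex q 0F) (vertex q 1F)
    n₀₁ = a≢b ∘ Equivalence.to (e₀~ (λ ()))
    n₀₂ : ¬ H.Adj (vertex q 0F) (vertex q 2F)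
    n₀₂ = a≢c ∘ Equivalence.to (e₀~ (λ ()))
    n₀₃ : ¬ H.Adj (vertex q 0F) (vertex q 3F)
    n₀₃ = a≢d ∘ Equivalence.to (e₀~ (λ ()))
    n₁₂ : ¬ H.Adj (vertex q 1F) (vertex q 2F)
    n₁₂ = αb≢c ∘ Equivalence.to e₁~e₂
    n₂₃ : ¬ H.Adj (vertex q 2F) (vertex q 3F)
    n₂₃ = βc≢d ∘ Equivalence.to e₂~e₃
    n₃₁ : ¬ H.Adj (vertex q 3F) (vertex q 1F)
    n₃₁ d~b = γ⁻b≢d (trans (cong (γ ⟨$⟩ˡ_) (sym (Equivalence.to e₃~e₁ d~b))) (inverseˡ γ))
    nonadj : Nonadjacent q
    nonadj 0F 0F = H.irrefl refl
    nonadj 0F 1F = n₀₁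
    nonadj 0F 2F = n₀₂
    nonadj 0F 3F = n₀₃
    nonadj 1F 0F = n₀₁ ∘ H.symm
    nonadj 1F 1F = H.irrefl refl
    nonadj 1F 2F = n₁₂
    nonadj 1F 3F = n₃₁ ∘ H.symm
    nonadj 2F 0F = n₀₂ ∘ H.symm
    nonadj 2F 1F = n₁₂ ∘ H.symm
    nonadj 2F 2F = H.irrefl refl
    nonadj 2F 3F = n₂₃
    nonadj 3F 0F = n₀₃ ∘ H.symm
    nonadj 3F 1F = n₃₁
    nonadj 3F 2F = n₂₃ ∘ H.symm
    nonadj 3F 3F = H.irrefl refl

  nonadjacent⇒proper : ∀ q → Nonadjacent q → Proper α β γ q
  nonadjacent⇒proper q nonadj =
    ( nonadj 0F 1F ∘ Equivalence.from (e₀~ (λ ()))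
    , nonadj 0F 2F ∘ Equivalence.from (e₀~ (λ ()))
    , nonadj 1F 2F ∘ Equivalence.from e₁~e₂ )
    , nonadj 0F 3F ∘ Equivalence.from (e₀~ (λ ()))
    , nonadj 2F 3F ∘ Equivalence.from e₂~e₃
    , (λ γ⁻b≡d → nonadj 3F 1F (Equivalence.from e₃~e₁ (trans (cong (γ ⟨$⟩ʳ_) (sym γ⁻b≡d)) (inverseʳ γ))))

  -- Properness of `T` belongs to the relation because uniqueness in either direction rests on `T`
  -- being a transversal.
  Represents : Subset H.order → Quadruple α β γ → Set
  Represents T q = IsProperColoring T × (∀ v → vertex q v ∈ˢ T)

  part-unique : ∀ {u v x} → x ∈ˢ L u → x ∈ˢ L v → u ≡ v
  part-unique {x = x} x∈u x∈v = let _ , _ , only = L-unique x in trans (sym (only x∈u)) (only x∈v)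

  transversal-unique : ∀ {T v x y} → IsTransversal T → x ∈ˢ T → x ∈ˢ L v → y ∈ˢ T → y ∈ˢ L v → x ≡ y
  transversal-unique {T} {v} tr x∈T x∈L y∈T y∈L =
    let _ , _ , only = ∣S∣≡1⇒unique (T ∩ L v) (tr v)
    in trans (only (x∈p∩q⁺ (x∈T , x∈L))) (sym (only (x∈p∩q⁺ (y∈T , y∈L))))

  represented-⊆ : ∀ {T T′ q} → Represents T q → Represents T′ q → ∀ {x} → x ∈ˢ T → x ∈ˢ T′
  represented-⊆ {T′ = T′} {q} ((tr , _) , q∈T) (_ , q∈T′) {x} x∈T =
    let v , x∈L , _ = L-unique x
    in subst (_∈ˢ T′) (transversal-unique tr (q∈T v) (e-∈ v _) x∈T x∈L) (q∈T′ v)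

  represented-unique : ∀ {T T′ q} → Represents T q → Represents T′ q → T ≡ T′
  represented-unique r r′ = ⊆-antisym (represented-⊆ r r′) (represented-⊆ r′ r)

  representing-unique : ∀ {q q′ T} → Represents T q → Represents T q′ → q ≡ q′
  representing-unique {q} {q′} ((tr , _) , q∈T) (_ , q′∈T) = coordinate-injective q q′
    λ v → e-injective v (transversal-unique tr (q∈T v) (e-∈ v _) (q′∈T v) (e-∈ v _))

  colorings-list : List (Subset H.order)
  colorings-list = filter isProperColoring? (allSubsets H.order)

  representing : ∀ {T} → T ∈ colorings-list → ∃ λ q → q ∈ properQuadruples α β γ × Represents T q
  representing {T} T∈ = q , ∈-properQuadruples α β γ (nonadjacent⇒proper q nonadj) , (tr , indep) , q∈T
    where
    coloring : IsProperColoring T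
    coloring = proj₂ (∈-filter⁻ isProperColoring? {xs = allSubsets H.order} T∈)
    tr = proj₁ coloring
    indep = proj₂ coloring
    choose : ∀ v → ∃ λ i → e v i ∈ˢ T
    choose v =
      let x , x∈ , _ = ∣S∣≡1⇒unique (T ∩ L v) (tr v)
          x∈T , x∈L = x∈p∩q⁻ T (L v) x∈
          i , i≡x = e-surjective v x∈L
      in i , subst (_∈ˢ T) (sym i≡x) x∈T
    q : Quadruple α β γ
    q = proj₁ (choose 0F) , proj₁ (choose 1F) , proj₁ (choose 2F) , proj₁ (choose 3F)
    q∈T : ∀ v → vertex q v ∈ˢ T
    q∈T 0F = proj₂ (choose 0F)
    q∈T 1F = proj₂ (choose 1F)
    q∈T 2F = proj₂ (choose 2F)
    q∈T 3F = proj₂ (choose 3F)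
    nonadj : Nonadjacent q
    nonadj u v = indep _ _ (q∈T u) (q∈T v)

  represented : ∀ {q} → q ∈ properQuadruples α β γ → ∃ λ T → T ∈ colorings-list × Represents T q
  represented {q} q∈ = T , ∈-filter⁺ isProperColoring? (∈-allSubsets T) coloring , coloring , q∈T
    where
    nonadj : Nonadjacent q
    nonadj = proper⇒nonadjacent q (proj₂ (∈-filter⁻ (proper? α β γ)
      {xs = cartesianProduct (allFin m) (cartesianProduct (allFin m) (cartesianProduct (allFin m) (allFin m)))} q∈))
    used? : Decidable (λ x → ∃ λ v → vertex q v ≡ x)
    used? x = any? λ v → vertex q v ≟ᶠ x
    T : Subset H.order
    T = comprehension used?
    q∈T : ∀ v → vertex q v ∈ˢ T
    q∈T v = ∈-comprehension⁺ used? (v , refl)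
    coloring : IsProperColoring T
    coloring = (λ v → unique⇒∣S∣≡1 (x∈p∩q⁺ (q∈T v , e-∈ v _)) (only v))
      , λ x y x∈T y∈T → separate (∈-comprehension⁻ used? x∈T) (∈-comprehension⁻ used? y∈T)
      where
      only : ∀ v {y} → y ∈ˢ T ∩ L v → y ≡ vertex q v
      only v {y} y∈ with y∈T , y∈L ← x∈p∩q⁻ T (L v) y∈ with u , refl ← ∈-comprehension⁻ used? y∈T =
        cong (vertex q) (part-unique (e-∈ u _) y∈L)
      separate : ∀ {x y} → (∃ λ u → vertex q u ≡ x) → (∃ λ v → vertex q v ≡ y) → ¬ H.Adj x y
      separate (u , refl) (v , refl) = nonadj u v

  P-DP≡colorings : + P-DP K₄ 𝓗 ≡ Count.colorings α β γ
  P-DP≡colorings = trans (cong +_ (ℕₚ.≤-antisym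
    (length-≤-by-relation Represents (Unique.filter⁺ isProperColoring? (allSubsets-unique H.order))
      representing (represented-unique))
    (length-≤-by-relation (λ q T → Represents T q) (properQuadruples-unique α β γ)
      represented (λ {q} {q′} → representing-unique {q} {q′}))))
    (length-properQuadruples α β γ)

-- Covers built from prescribed matchings

-- The vertices of the cover are the pairs in Fin 4 × Fin m, encoded in Fin (4 m);
-- x in part u is matched to σ u v x in part v.
module VoltageCover {m} .{{_ : NonZero m}} (σ : Fin 4 → Fin 4 → Fin m → Fin m)
  (σ-inverse : ∀ u v i → σ v u (σ u v i) ≡ i) where

  abstract
    order : ℕ
    order = 4 ℕ.* m

    order-nonZero : NonZero order
    order-nonZero = ℕₚ.m*n≢0 4 m

    vertex : Fin 4 → Fin m → Fin order
    vertex = combine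

    part : Fin order → Fin 4
    part x = proj₁ (remQuot {4} m x)

    position : Fin order → Fin m
    position x = proj₂ (remQuot {4} m x)

    part-vertex : ∀ u i → part (vertex u i) ≡ u
    part-vertex u i = cong proj₁ (remQuot-combine {4} {m} u i)

    position-vertex : ∀ u i → position (vertex u i) ≡ i
    position-vertex u i = cong proj₂ (remQuot-combine {4} {m} u i)

    vertex-part : ∀ {x u} → part x ≡ u → vertex u (position x) ≡ x
    vertex-part {x} refl = combine-remQuot {4} m x

    L : Fin 4 → Subset (order)
    L v = comprehension (λ x → part x ≟ᶠ v)

    ∈-L⁺ : ∀ {x v} → part x ≡ v → x ∈ˢ L v
    ∈-L⁺ {v = v} = ∈-comprehension⁺ (λ x → part x ≟ᶠ v)

    ∈-L⁻ : ∀ {x v} → x ∈ˢ L v → part x ≡ v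
    ∈-L⁻ {v = v} = ∈-comprehension⁻ (λ x → part x ≟ᶠ v)

  H : Graph
  H = record
    { order    = order
    ; nonempty = order-nonZero
    ; Adj      = λ x y → part x ≢ part y × σ (part x) (part y) (position x) ≡ position y
    ; adj?     = λ x y → ¬? (part x ≟ᶠ part y) ×-dec (σ (part x) (part y) (position x) ≟ᶠ position y)
    ; irrefl   = λ { refl (u≢u , _) → u≢u refl }
    ; symm     = λ {x} {y} (u≢v , eq) → u≢v ∘ sym , trans (cong (σ _ _) (sym eq)) (σ-inverse (part x) (part y) (position x))
    }
  module H = Graph H
  open EdgesBetween H

  vertex-∈ : ∀ v i → vertex v i ∈ˢ L v
  vertex-∈ v i = ∈-L⁺ (part-vertex v i)

  vertex-injective : ∀ v {i j : Fin m} → vertex v i ≡ vertex v j → i ≡ j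
  vertex-injective v {i} {j} eq = trans (sym (position-vertex v i)) (trans (cong position eq) (position-vertex v j))

  vertex-surjective : ∀ v {x} → x ∈ˢ L v → ∃ λ i → vertex v i ≡ x
  vertex-surjective v {x} x∈ = position x , vertex-part (∈-L⁻ x∈)

  adj-vertex : ∀ {u v} → u ≢ v → ∀ {i j} → H.Adj (vertex u i) (vertex v j) ⇔ σ u v i ≡ j
  adj-vertex {u} {v} u≢v {i} {j} = mk⇔
    (λ (_ , eq) → trans (sym σ≡) (trans eq (position-vertex v j)))
    (λ eq → (λ same → u≢v (trans (sym (part-vertex u i)) (trans same (part-vertex v j))))
          , trans σ≡ (trans eq (sym (position-vertex v j))))
    where
    σ≡ : σ (part (vertex u i)) (part (vertex v j)) (position (vertex u i)) ≡ σ u v i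
    σ≡ = trans (cong₂ (λ p q → σ p q (position (vertex u i))) (part-vertex u i) (part-vertex v j))
               (cong (σ u v) (position-vertex u i))

  neighbour-unique : ∀ {v x y y′} → H.Adj x y → H.Adj x y′ → y ∈ˢ L v → y′ ∈ˢ L v → y ≡ y′
  neighbour-unique {v} {x} {y} {y′} (_ , eq) (_ , eq′) y∈ y′∈ =
    trans (sym (vertex-part (∈-L⁻ y∈)))
      (trans (cong (vertex v) (trans (sym eq)
        (trans (cong (λ w → σ (part x) w (position x)) (trans (∈-L⁻ y∈) (sym (∈-L⁻ y′∈)))) eq′)))
      (vertex-part (∈-L⁻ y′∈)))

  Ends : H.V × H.V → H.V → H.V → Set
  Ends e x y = e ≡ (x , y) ⊎ e ≡ (y , x)

  endpoint⁻ : ∀ {e x y z} → Ends e x y → H.Endpoint z e → z ≡ x ⊎ z ≡ y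
  endpoint⁻ (inj₁ refl) end        = end
  endpoint⁻ (inj₂ refl) (inj₁ z≡y) = inj₂ z≡y
  endpoint⁻ (inj₂ refl) (inj₂ z≡x) = inj₁ z≡x

  endpoint⁺ : ∀ {e x y} → Ends e x y → H.Endpoint x e
  endpoint⁺ (inj₁ refl) = inj₁ refl
  endpoint⁺ (inj₂ refl) = inj₂ refl

  different-parts : ∀ {u v x y} → u ≢ v → x ∈ˢ L u → y ∈ˢ L v → x ≢ y
  different-parts u≢v x∈ y∈ refl = u≢v (trans (sym (∈-L⁻ x∈)) (∈-L⁻ y∈))

  -- Disjointness of the parts forces the shared endpoint to be the end of both edges in `L u`, or
  -- of both in `L v`. Neighbours within a part are unique, so the opposite ends coincide too.
  matching : ∀ {u v} → u ≢ v → H.IsMatching (H.edgesBetween (L u) (L v))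
  matching {u} {v} u≢v {e} {f} e∈ f∈ z z∈e z∈f
    with x , y , x~y , x∈ , y∈ , e-ends ← edge⇒adj (L u) (L v) e∈
       | x′ , y′ , x′~y′ , x′∈ , y′∈ , f-ends ← edge⇒adj (L u) (L v) f∈
    with endpoint⁻ e-ends z∈e | endpoint⁻ f-ends z∈f
  ... | inj₁ refl | inj₂ refl = contradiction refl (different-parts u≢v x∈ y′∈)
  ... | inj₂ refl | inj₁ refl = contradiction refl (different-parts u≢v x′∈ y∈)
  ... | inj₁ refl | inj₁ refl =
    same-ends⇒≡ (L u) (L v) e∈ f∈ e-ends
      (subst (Ends f x) (neighbour-unique x′~y′ x~y y′∈ y∈) f-ends)
  ... | inj₂ refl | inj₂ refl =
    same-ends⇒≡ (L u) (L v) e∈ f∈ e-ends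
      (subst (λ w → Ends f w y) (neighbour-unique (H.symm x′~y′) (H.symm x~y) x′∈ x∈) f-ends)

  ∈-edgesBetween⁻ : ∀ {A B e} → e ∈ H.edgesBetween A B → e ∈ H.edges
  ∈-edgesBetween⁻ {A} {B} e∈ = proj₁ (∈-filter⁻ (H.joins? A B) {xs = H.edges} e∈)

  cover : Cover K₄
  cover = record
    { H          = H
    ; L          = L
    ; L-nonempty = λ v → vertex v (point m) , vertex-∈ v (point m)
    ; L-unique   = λ x → part x , ∈-L⁺ refl , λ x∈ → ∈-L⁻ x∈
    ; matching   = matching
    ; H-edges    = λ e → mk⇔ (crossing e) (λ (u , v , _ , e∈) → ∈-edgesBetween⁻ {L u} {L v} e∈)
    }
    where
    point : ∀ m .{{_ : NonZero m}} → Fin m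
    point (suc _) = zero
    crossing : ∀ e → e ∈ H.edges → ∃ λ u → ∃ λ v → u ≢ v × e ∈ H.edgesBetween (L u) (L v)
    crossing (x , y) e∈ = part x , part y , proj₁ (proj₂ (∈-edges⁻ e∈))
      , ∈-filter⁺ (H.joins? (L (part x)) (L (part y))) e∈ (inj₁ (∈-L⁺ refl , ∈-L⁺ refl))

  ∣L∣≡m : ∀ v → ∣ L v ∣ ≡ m
  ∣L∣≡m v = ℕₚ.≤-antisym
    (injective⇒≤ {f = λ k → position (enumerate (L v) k)} λ {k} {l} eq → enumerate-injective (L v)
      (trans (sym (vertex-part (∈-L⁻ (enumerate-∈ (L v) k))))
        (trans (cong (vertex v) eq) (vertex-part (∈-L⁻ (enumerate-∈ (L v) l))))))
    (injective⇒≤ {f = λ i → proj₁ (enumerate-surjective (L v) (vertex-∈ v i))} λ {i} {j} eq → vertex-injective v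
      (trans (sym (proj₂ (enumerate-surjective (L v) (vertex-∈ v i))))
        (trans (cong (enumerate (L v)) eq) (proj₂ (enumerate-surjective (L v) (vertex-∈ v j))))))

  module _ {u v : Fin 4} (u≢v : u ≢ v) where
    -- Membership of e is repeated inside the relation, since left uniqueness sees nothing else and
    -- has to appeal to `matching`.
    EdgeAt : H.V × H.V → Fin m → Set
    EdgeAt e i = e ∈ H.edgesBetween (L u) (L v) × H.Endpoint (vertex u i) e

    edge-at : ∀ i → ∃ λ e → e ∈ H.edgesBetween (L u) (L v) × EdgeAt e i
    edge-at i =
      let e , e∈ , e-ends = adj⇒edge (L u) (L v) (Equivalence.from (adj-vertex u≢v) refl)
                              (vertex-∈ u i) (vertex-∈ v (σ u v i))
      in e , e∈ , e∈ , endpoint⁺ e-ends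

    position-at : ∀ {e} → e ∈ H.edgesBetween (L u) (L v) → ∃ λ i → i ∈ allFin m × EdgeAt e i
    position-at {e} e∈ =
      let x , y , _ , x∈ , _ , e-ends = edge⇒adj (L u) (L v) e∈
      in position x , ∈-allFin _ , e∈ ,
         subst (λ w → H.Endpoint w e) (sym (vertex-part (∈-L⁻ x∈))) (endpoint⁺ e-ends)

    position-unique : ∀ {e i j} → EdgeAt e i → EdgeAt e j → i ≡ j
    position-unique {e} (e∈ , i∈e) (_ , j∈e) with x , y , _ , x∈ , y∈ , e-ends ← edge⇒adj (L u) (L v) e∈
      = vertex-injective u (trans (start i∈e) (sym (start j∈e)))
      where
      start : ∀ {k} → H.Endpoint (vertex u k) e → vertex u k ≡ x
      start {k} k∈e with endpoint⁻ e-ends k∈e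
      ... | inj₁ ≡x = ≡x
      ... | inj₂ ≡y = contradiction ≡y (different-parts u≢v (vertex-∈ u k) y∈)

    ∣edgesBetween∣≡m : length (H.edgesBetween (L u) (L v)) ≡ m
    ∣edgesBetween∣≡m = trans (ℕₚ.≤-antisym
      (length-≤-by-relation EdgeAt {ys = allFin m} (edgesBetween-unique (L u) (L v)) position-at
        (λ (e∈ , i∈e) (f∈ , i∈f) → matching u≢v e∈ f∈ _ i∈e i∈f))
      (length-≤-by-relation (λ i e → EdgeAt e i) (Unique.allFin⁺ m) (λ {i} _ → edge-at i) position-unique))
      (length-tabulate {n = m} (λ i → i))

  full : Cover.IsFullFold cover m
  full = ∣L∣≡m , ∣edgesBetween∣≡m

module _ {m} .{{_ : NonZero m}} (α β γ : Permutation′ m) where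
  σ : Fin 4 → Fin 4 → Fin m → Fin m
  σ 1F 2F = α ⟨$⟩ʳ_
  σ 2F 1F = α ⟨$⟩ˡ_
  σ 2F 3F = β ⟨$⟩ʳ_
  σ 3F 2F = β ⟨$⟩ˡ_
  σ 3F 1F = γ ⟨$⟩ʳ_
  σ 1F 3F = γ ⟨$⟩ˡ_
  -- This clause serves the edges at `0F`, whose matchings are identities, and the diagonal, which
  -- `Adj` excludes.
  σ _  _  = λ i → i

  σ-inverse : ∀ u v i → σ v u (σ u v i) ≡ i
  σ-inverse 1F 2F _ = inverseˡ α
  σ-inverse 2F 1F _ = inverseʳ α
  σ-inverse 2F 3F _ = inverseˡ β
  σ-inverse 3F 2F _ = inverseʳ β
  σ-inverse 3F 1F _ = inverseˡ γ
  σ-inverse 1F 3F _ = inverseʳ γ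
  σ-inverse 0F 0F _ = refl
  σ-inverse 0F 1F _ = refl
  σ-inverse 0F 2F _ = refl
  σ-inverse 0F 3F _ = refl
  σ-inverse 1F 0F _ = refl
  σ-inverse 2F 0F _ = refl
  σ-inverse 3F 0F _ = refl
  σ-inverse 1F 1F _ = refl
  σ-inverse 2F 2F _ = refl
  σ-inverse 3F 3F _ = refl

  open VoltageCover σ σ-inverse public using (cover; full)
  open VoltageCover σ σ-inverse using (vertex; vertex-∈; vertex-injective; vertex-surjective; adj-vertex)

  cover-coordinates : Coordinates cover m
  cover-coordinates = record
    { e = vertex ; e-∈ = vertex-∈ ; e-injective = vertex-injective ; e-surjective = vertex-surjective
    ; α = α ; β = β ; γ = γ
    ; e₀~ = λ {v} 0≢v {i} {j} → subst (λ τ → Graph.Adj (Cover.H cover) (vertex 0F i) (vertex v j) ⇔ τ i ≡ j) (σ0 v) (adj-vertex 0≢v)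
    ; e₁~e₂ = adj-vertex {1F} {2F} (λ ()) ; e₂~e₃ = adj-vertex {2F} {3F} (λ ()) ; e₃~e₁ = adj-vertex {3F} {1F} (λ ()) }
    where
    σ0 : ∀ v → σ 0F v ≡ (λ i → i)
    σ0 0F = refl
    σ0 1F = refl
    σ0 2F = refl
    σ0 3F = refl

-- The maximum and the theorem

P-DP≤formula : ∀ {m} → 2 ≤ m → (𝓗 : Cover K₄) → Cover.IsFullFold 𝓗 m → + P-DP K₄ 𝓗 ≤ᶻ formula m
P-DP≤formula {m} 2≤m 𝓗 full = begin
  + P-DP K₄ 𝓗                     ≡⟨ ProperColorings.P-DP≡colorings coords ⟩
  Count.colorings α β γ           ≤⟨ bound ⟩
  quartic (+ m) - + defect m     ≡⟨ formula≡ m ⟨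
  formula m                       ∎
  where
  open ℤₚ.≤-Reasoning
  coords = coordinates 𝓗 full
  open Coordinates coords using (α; β; γ)
  bound : Count.colorings α β γ ≤ᶻ quartic (+ m) - + defect m
  bound with 2 ∣? m
  ... | yes 2∣m = subst (λ d → Count.colorings α β γ ≤ᶻ quartic (+ m) - + d) (sym (even⇒defect≡0 m 2∣m))
          (ℤₚ.≤-trans (Deficiency.colorings≤quartic α β γ 2≤m) (ℤₚ.≤-reflexive (sym (ℤₚ.+-identityʳ (quartic (+ m))))))
  ... | no 2∤m  = subst (λ d → Count.colorings α β γ ≤ᶻ quartic (+ m) - + d) (sym (odd⇒defect≡3 m 2∤m))
          (Deficiency.colorings≤quartic-3 α β γ 2≤m 2∤m)

optimalCover : ∀ m → 2 ≤ m → ∃ λ (𝓗 : Cover K₄) → Cover.IsFullFold 𝓗 m × + P-DP K₄ 𝓗 ≡ formula m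
optimalCover (suc zero) (s≤s ())
optimalCover m@(suc (suc _)) _ with π , π≢id , disagree ← derangement m (λ ()) =
  cover π (flip π) (flip π) , full π (flip π) (flip π) , (begin
    + P-DP K₄ (cover π (flip π) (flip π))
      ≡⟨ ProperColorings.P-DP≡colorings (cover-coordinates π (flip π) (flip π)) ⟩
    c
      ≡⟨ cancel c (+ defect m) ⟩
    (c + + defect m) - + defect m
      ≡⟨ cong (λ d → (c + d) - + defect m) disagree ⟨
    (c + disagreement (π ⟨$⟩ʳ_) (π ⟨$⟩ˡ_)) - + defect m
      ≡⟨ cong (_- + defect m) (derangement-colorings π π≢id) ⟩
    quartic (+ m) - + defect m
      ≡⟨ formula≡ m ⟨
    formula m ∎)
  where
  open ≡-Reasoning
  c : ℤ
  c = Count.colorings π (flip π) (flip π)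
  cancel : ∀ c d → c ≡ (c + d) - d
  cancel = solve-∀

P*-DP : ∀ m → 2 ≤ m → ∃[ k ] (IsP*-DP K₄ m k × + k ≡ formula m)
P*-DP m 2≤m = P-DP K₄ 𝓗 , record
  { attained = 𝓗 , full-𝓗 , refl
  ; maximal  = λ 𝓗′ full′ → ℤₚ.drop‿+≤+ (subst (+ P-DP K₄ 𝓗′ ≤ᶻ_) (sym P≡formula) (P-DP≤formula 2≤m 𝓗′ full′)) }
  , P≡formula
  where
  𝓗 = proj₁ (optimalCover m 2≤m)
  full-𝓗 = proj₁ (proj₂ (optimalCover m 2≤m))
  P≡formula = proj₂ (proj₂ (optimalCover m 2≤m))

-- The difference argument takes a sequence on all of ℕ; `value-spec` determines this one from 2 on.
value : ℕ → ℕ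
value m with 2 ≤? m
... | yes 2≤m = proj₁ (P*-DP m 2≤m)
... | no _    = 0

value-spec : ∀ m → 2 ≤ m → IsP*-DP K₄ m (value m) × + value m ≡ formula m
value-spec m 2≤m with 2 ≤? m
... | yes 2≤m′ = proj₂ (P*-DP m 2≤m′)
... | no 2≰m   = contradiction 2≤m 2≰m

theorem3 : ∀ {c ℓ} →
    (∀ (m : ℕ) → 2 ≤ m → ∃[ k ] (IsP*-DP K₄ m k × + k ≡ formula m))
    ×
    (∀ (R : CommutativeRing c ℓ) → CharacteristicZero R →
    ¬ (∃[ N ] ∃[ p ] (1 ≤ N ×
    (∀ m → N ≤ m → ∀ k → IsP*-DP K₄ m k →
    CommutativeRing._≈_ R (natEmbed R k) (eval R p (natEmbed R m))))))
theorem3 = P*-DP , λ R char0 (N , p , 1≤N , agrees) →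
  FiniteDifferences.not-polynomial R char0 value
    (λ m 2≤m → formula-ℕ m (value m) (proj₂ (value-spec m 2≤m)))
    -- Raising the threshold to `suc N` guarantees m ≥ 2, the range in which `value-spec` applies.
    (suc N) p (s≤s z≤n)
    (λ m 1+N≤m → agrees m (ℕₚ.<⇒≤ 1+N≤m) (value m) (proj₁ (value-spec m (ℕₚ.≤-trans (s≤s 1≤N) 1+N≤m))))
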